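{- Let $m$ be a fixed integer. There is a function $\varepsilon(n)\to 0$ as $n\to\infty$ such that for every $n$ there exists a graph $G$ on $n$ vertices with $\alpha_m(G)\ge 3$ and $\alpha(G)\le n^{\frac{4+\varepsilon(n)}{m+2}}$ if $m\ge 6$ is even, and $\alpha(G)\le n^{\frac{4+\varepsilon(n)}{m+3-13/\sqrt m}}$ if $m\ge 5$ is odd.
   Context: $\alpha(G)$ is the independence number; $\alpha_m(G)\ge 3$ means every set of $m$ vertices of $G$ contains an independent set of size $3$. -}

module Defs where

open import Level using (0ℓ)
open import Data.Nat using (ℕ; _+_; _*_; _∸_; _^_; _≤_; _<_)
open import Data.Nat.Base using (_%_)
open import Data.Fin using (Fin)
open import Data.Fin.Subset using (Subset; _∈_; _⊆_; ∣_∣)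
open import Data.Product using (Σ; _×_; ∃-syntax)
open import Relation.Nullary using (¬_)
open import Relation.Binary.PropositionalEquality using (_≡_)

record Graph (n : ℕ) : Set₁ where
  field
    Adj     : Fin n → Fin n → Set
    sym     : ∀ {i j} → Adj i j → Adj j i
    irrefl  : ∀ {i} → ¬ Adj i i
open Graph public

Independent : ∀ {n} → Graph n → Subset n → Set
Independent G S = ∀ i j → i ∈ S → j ∈ S → ¬ Adj G i j

AlphaAtMost : ∀ {n} → Graph n → ℕ → Set
AlphaAtMost G k = ∀ S → Independent G S → ∣ S ∣ ≤ k

AlphaMAtLeast3 : ∀ {n} → ℕ → Graph n → Set
AlphaMAtLeast3 {n} m G =
  ∀ (S : Subset n) → ∣ S ∣ ≡ m →
  ∃[ T ] (T ⊆ S × ∣ T ∣ ≡ 3 × Independent G T)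

-- For a rational c = p / q (q > 0), "c > 4 / d(m)" where
--   d(m) = m + 2                 if m is even,
--   d(m) = m + 3 - 13 / √m        if m is odd.
-- Even: p (m+2) > 4 q.
-- Odd : p (m+3) - 13 p / √m > 4 q  ⇔  p(m+3) > 4q  ∧  (p(m+3) - 4q)² · m > 169 p².
ExponentAbove : ℕ → ℕ → ℕ → Set
ExponentAbove m p q with m % 2
... | 0 = 4 * q < p * (m + 2)
... | _ = (4 * q < p * (m + 3)) ×
          (169 * (p * p) < ((p * (m + 3)) ∸ (4 * q)) * ((p * (m + 3)) ∸ (4 * q)) * m)

{-# OPTIONS --safe #-}
module Submission where

open import Defs hiding (sym)
open import Data.Nat using (ℕ; _≤_; _<_; _^_)
open import Data.Product using (Σ; _×_; ∃-syntax)

open import Data.Bool using (Bool; true; false; not; _∧_; if_then_else_)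
import Data.Bool.Properties as Boolₚ
open import Data.Empty using (⊥; ⊥-elim)
open import Data.Fin using (Fin; zero; suc; combine; remQuot; toℕ)
import Data.Fin.Properties as Finₚ
open import Data.Fin.Subset using (Subset; inside; outside; ∣_∣; _⊆_)
  renaming (_∈_ to _∈ₛ_; ⊥ to ∅)
open import Data.Fin.Subset.Properties using (∉⊥; ∣⊥∣≡0; ∣p∣≤n)
open import Data.List
  using (List; []; _∷_; _++_; length; map; concat; concatMap; filter; foldr; take; drop
        ; allFin; upTo; cartesianProduct; cartesianProductWith)
open import Data.List.Properties
  using (length-++; length-take; length-map; length-filter; length-tabulate
        ; map-++; map-cong; take++drop≡id)
open import Data.List.Membership.Propositional using (_∈_; _∉_; find; lose)
open import Data.List.Membership.Propositional.Properties
  using (∈-++⁺ˡ; ∈-++⁺ʳ; ∈-++⁻; ∈-∃++; ∈-map⁺; ∈-map⁻; ∈-filter⁺; ∈-filter⁻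
        ; ∈-concat⁺′; ∈-concat⁻′; ∈-concatMap⁺; ∈-concatMap⁻
        ; ∈-cartesianProduct⁺; ∈-cartesianProduct⁻; ∈-cartesianProductWith⁺; ∈-cartesianProductWith⁻
        ; ∈-allFin; ∈-upTo⁺; ∈-upTo⁻)
import Data.List.Membership.DecPropositional as DecMembership
open import Data.List.Relation.Binary.Permutation.Propositional
  using (_↭_; ↭-refl; ↭-sym; ↭-trans; ↭-reflexive; prep; swap; ↭⇒↭ₛ)
import Data.List.Relation.Binary.Permutation.Propositional.Properties as ↭ₚ
import Data.List.Relation.Binary.Permutation.Setoid.Properties as ↭ₛₚ
open import Data.List.Relation.Unary.All as All using (All; []; _∷_)
open import Data.List.Relation.Unary.All.Properties using (¬Any⇒All¬)
open import Data.List.Relation.Unary.AllPairs using ([]; _∷_)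
open import Data.List.Relation.Unary.Any using (here; there; any?)
open import Data.List.Relation.Unary.Unique.Propositional using (Unique)
import Data.List.Relation.Unary.Unique.Propositional.Properties as Uniqueₚ
open Uniqueₚ using (Unique[x∷xs]⇒x∉xs)
import Data.List.Relation.Unary.Unique.DecPropositional as DecUnique
open import Data.Nat
open import Data.Nat.DivMod using (m≡m%n+[m/n]*n; m%n<n)
open import Data.Nat.ListAction using (sum)
open import Data.Nat.ListAction.Properties using (sum-++; sum-↭)
open import Data.Nat.Properties
open import Data.Nat.Tactic.RingSolver using (solve-∀)
import Data.Product as Product
open import Data.Product using (_,_; proj₁; proj₂)
open import Data.Sum using (_⊎_; inj₁; inj₂)
open import Data.Vec using (Vec; []; _∷_; lookup; replicate; _[_]≔_; here; there)
open import Data.Vec.Properties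
  using (lookup∘update; lookup∘update′; lookup-replicate; []=⇒lookup; lookup⇒[]=)
open import Function using (_∘_; id)
open import Relation.Binary.PropositionalEquality
  using (_≡_; _≢_; refl; sym; trans; cong; cong₂; subst; subst₂; setoid)
open import Relation.Nullary using (¬_; Dec; yes; no; does; contradiction)
open import Relation.Nullary.Decidable using (_×-dec_; ¬?)
open import Relation.Unary using (Decidable)

-- Call a graph with v vertices and e edges dense if q (v - 2) < p (e - 1).
--
-- Every m-vertex graph without an independent triple has a dense subgraph.  Let F be
-- its complement, which is triangle-free.  For m = 2h, either some F-degree is at least h,
-- and an F-neighbourhood contains an h-clique, or the whole graph has at least h² edges.
-- For m = 2h + 1 one may assume that all F-degrees are at most h and that F has more than
-- h² - h/2 edges.  Then some u has F-degree h and an F-neighbour v of F-degree at least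
-- h - 1, so all but two vertices y, z are covered by a clique A of size h and a disjoint
-- clique B of size h - 1.  If y or z has few F-neighbours in A, add it to A; if both have
-- few in B, add both to B; otherwise one of them has at least about √(h/2) on either side,
-- and the F-edges that triangle-freeness then excludes make the whole graph dense.
--
-- It remains to find a graph on n vertices without dense subgraphs on at most m vertices
-- in which every set of t > n^(p/q) vertices spans an edge.  Take a random graph of edge
-- probability 1/(L+1), with L about t / log n, and delete a maximal family of edge-disjoint
-- dense subgraphs.  If a t-set T is independent afterwards, then its random edges are
-- covered by edge-disjoint copies meeting T.  The expected number of such pairs
-- (T, covering) is below 1, because the expected number of copies through a given pair of
-- vertices is at most half the edge probability.

open ≤-Reasoning

-- Sums over lists and sparse sets of vertices in triangle-free graphs

≤-by : ∀ {a b} c → a + c ≡ b → a ≤ b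
≤-by {a} c refl = m≤m+n a c

⟦_⟧ : Bool → ℕ
⟦ b ⟧ = if b then 1 else 0

⟦⟧≤1 : ∀ b → ⟦ b ⟧ ≤ 1
⟦⟧≤1 true  = ≤-refl
⟦⟧≤1 false = z≤n

module _ {A : Set} where

  total : (A → ℕ) → List A → ℕ
  total f = sum ∘ map f

  total-++ : ∀ f xs ys → total f (xs ++ ys) ≡ total f xs + total f ys
  total-++ f xs ys = trans (cong sum (map-++ f xs ys)) (sum-++ (map f xs) (map f ys))

  total-↭ : ∀ f {xs ys} → xs ↭ ys → total f xs ≡ total f ys
  total-↭ f p = sum-↭ (↭ₚ.map⁺ f p)

  total-cong : ∀ {f g} → (∀ x → f x ≡ g x) → ∀ xs → total f xs ≡ total g xs
  total-cong f≗g xs = cong sum (map-cong f≗g xs)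

  total-+ : ∀ f g xs → total (λ x → f x + g x) xs ≡ total f xs + total g xs
  total-+ f g []       = refl
  total-+ f g (x ∷ xs) = trans (cong (f x + g x +_) (total-+ f g xs)) (lemma (f x) (g x) _ _)
    where
    lemma : ∀ a b c d → a + b + (c + d) ≡ a + c + (b + d)
    lemma = solve-∀

  total-mono : ∀ {f g} xs → (∀ {x} → x ∈ xs → f x ≤ g x) → total f xs ≤ total g xs
  total-mono []       f≤g = z≤n
  total-mono (x ∷ xs) f≤g = +-mono-≤ (f≤g (here refl)) (total-mono xs (f≤g ∘ there))

  total-const : ∀ c xs → total (λ _ → c) xs ≡ length xs * c
  total-const c []       = refl
  total-const c (x ∷ xs) = cong (c +_) (total-const c xs)

  total-≤ : ∀ {f} c xs → (∀ {x} → x ∈ xs → f x ≤ c) → total f xs ≤ length xs * c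
  total-≤ c xs f≤c = ≤-trans (total-mono xs f≤c) (≤-reflexive (total-const c xs))

  total-*ʳ : ∀ f c xs → total (λ x → f x * c) xs ≡ total f xs * c
  total-*ʳ f c []       = refl
  total-*ʳ f c (x ∷ xs) = trans (cong (f x * c +_) (total-*ʳ f c xs)) (sym (*-distribʳ-+ c (f x) _))

  ∃∈⊎∀∈ : ∀ {P : A → Set} → Decidable P → ∀ xs → (∃[ x ] (x ∈ xs × P x)) ⊎ (∀ {x} → x ∈ xs → ¬ P x)
  ∃∈⊎∀∈ P? xs with any? P? xs
  ... | yes p = inj₁ (find p)
  ... | no ¬p = inj₂ (All.lookup (¬Any⇒All¬ xs ¬p))

  Unique-↭ : ∀ {xs ys : List A} → xs ↭ ys → Unique xs → Unique ys
  Unique-↭ p = ↭ₛₚ.Unique-resp-↭ (setoid A) (↭⇒↭ₛ p)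

  Unique-++⁻ʳ : ∀ (xs : List A) {ys} → Unique (xs ++ ys) → Unique ys
  Unique-++⁻ʳ []       u       = u
  Unique-++⁻ʳ (x ∷ xs) (_ ∷ u) = Unique-++⁻ʳ xs u

  Unique-++⁻ˡ : ∀ (xs : List A) {ys} → Unique (xs ++ ys) → Unique xs
  Unique-++⁻ˡ []       _        = []
  Unique-++⁻ˡ (x ∷ xs) (x∉ ∷ u) = All.tabulate (λ p → All.lookup x∉ (∈-++⁺ˡ p)) ∷ Unique-++⁻ˡ xs u

  ∈-take : ∀ k (xs : List A) {x} → x ∈ take k xs → x ∈ xs
  ∈-take (suc k) (x ∷ xs) (here p)  = here p
  ∈-take (suc k) (x ∷ xs) (there p) = there (∈-take k xs p)

  filter-↭-++ : ∀ {P : A → Set} (P? : Decidable P) xs → xs ↭ filter P? xs ++ filter (¬? ∘ P?) xs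
  filter-↭-++ P? []       = ↭-refl
  filter-↭-++ P? (x ∷ xs) with P? x
  ... | yes _ = prep x (filter-↭-++ P? xs)
  ... | no  _ = ↭-trans (prep x (filter-↭-++ P? xs)) (↭-sym (↭ₚ.shift x _ _))

total-swap : ∀ {A B : Set} (f : A → B → ℕ) xs ys →
  total (λ x → total (f x) ys) xs ≡ total (λ y → total (λ x → f x y) xs) ys
total-swap f []       ys = sym (trans (total-const 0 ys) (*-zeroʳ (length ys)))
total-swap f (x ∷ xs) ys =
  trans (cong (total (f x) ys +_) (total-swap f xs ys)) (sym (total-+ (f x) _ ys))

-- Degrees and edge counts of a symmetric relation, later the complement of the constructed graph

module Symmetric {A : Set} (F : A → A → Bool) (F-sym : ∀ x y → F x y ≡ F y x)
                 (F-irrefl : ∀ x → F x x ≡ false) where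

  deg : A → List A → ℕ
  deg x = total (λ y → ⟦ F x y ⟧)

  edges : List A → ℕ
  edges []       = 0
  edges (x ∷ xs) = deg x xs + edges xs

  cross : List A → List A → ℕ
  cross xs ys = total (λ x → deg x ys) xs

  nbrs : A → List A → List A
  nbrs x = filter (λ y → F x y Boolₚ.≟ true)

  nonnbrs : A → List A → List A
  nonnbrs x = filter (λ y → ¬? (F x y Boolₚ.≟ true))

  nbrs-↭ : ∀ x ys → ys ↭ nbrs x ys ++ nonnbrs x ys
  nbrs-↭ x = filter-↭-++ (λ y → F x y Boolₚ.≟ true)

  length-nbrs : ∀ x ys → length (nbrs x ys) ≡ deg x ys
  length-nbrs x []       = refl
  length-nbrs x (y ∷ ys) with F x y
  ... | true  = cong suc (length-nbrs x ys)
  ... | false = length-nbrs x ys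

  ∈-nbrs : ∀ x ys {y} → y ∈ nbrs x ys → y ∈ ys × F x y ≡ true
  ∈-nbrs x ys = ∈-filter⁻ (λ y → F x y Boolₚ.≟ true)

  cross-sym : ∀ xs ys → cross xs ys ≡ cross ys xs
  cross-sym xs ys = trans (total-swap (λ x y → ⟦ F x y ⟧) xs ys)
    (total-cong (λ y → total-cong (λ x → cong ⟦_⟧ (F-sym x y)) xs) ys)

  cross-singleton : ∀ xs y → total (λ x → ⟦ F x y ⟧) xs ≡ deg y xs
  cross-singleton xs y = total-cong (λ x → cong ⟦_⟧ (F-sym x y)) xs

  handshake : ∀ xs → total (λ x → deg x xs) xs ≡ 2 * edges xs
  handshake []       = refl
  handshake (x ∷ xs)
    rewrite F-irrefl x
          | total-+ (λ y → ⟦ F y x ⟧) (λ y → deg y xs) xs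
          | cross-singleton xs x
          | handshake xs = lemma (deg x xs) (edges xs)
    where
    lemma : ∀ d e → d + (d + 2 * e) ≡ 2 * (d + e)
    lemma = solve-∀

  -- The recursion for `edges` follows the order of the list, but by `handshake` twice its value is
  -- a sum of degrees, which any permutation preserves.
  edges-↭ : ∀ {xs ys} → xs ↭ ys → edges xs ≡ edges ys
  edges-↭ {xs} {ys} p = *-cancelˡ-≡ _ _ 2 (trans (sym (handshake xs)) (trans
    (trans (total-cong (λ x → total-↭ _ p) xs) (total-↭ _ p)) (handshake ys)))

  edges-++ : ∀ xs ys → edges (xs ++ ys) ≡ edges xs + cross xs ys + edges ys
  edges-++ []       ys = refl
  edges-++ (x ∷ xs) ys
    rewrite total-++ (λ y → ⟦ F x y ⟧) xs ys | edges-++ xs ys =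
      lemma (deg x xs) (deg x ys) (edges xs) (cross xs ys) (edges ys)
    where
    lemma : ∀ a b c d e → a + b + (c + d + e) ≡ a + c + (b + d) + e
    lemma = solve-∀

  deg≤length : ∀ x ys → deg x ys ≤ length ys
  deg≤length x ys = ≤-trans (total-≤ 1 ys (λ _ → ⟦⟧≤1 _)) (≤-reflexive (*-identityʳ _))

  deg≡0 : ∀ x ys → (∀ {y} → y ∈ ys → F x y ≡ true → ⊥) → deg x ys ≡ 0
  deg≡0 x []       h = refl
  deg≡0 x (y ∷ ys) h with F x y in eq
  ... | true  = ⊥-elim (h (here refl) eq)
  ... | false = deg≡0 x ys (h ∘ there)

  edges≡0 : ∀ xs → (∀ {x y} → x ∈ xs → y ∈ xs → F x y ≡ true → ⊥) → edges xs ≡ 0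
  edges≡0 []       h = refl
  edges≡0 (x ∷ xs) h = cong₂ _+_ (deg≡0 x xs (h (here refl) ∘ there))
                                 (edges≡0 xs (λ p q → h (there p) (there q)))

  TriangleFree : List A → Set
  TriangleFree xs = ∀ {x y z} → x ∈ xs → y ∈ xs → z ∈ xs →
    F x y ≡ true → F x z ≡ true → F y z ≡ true → ⊥

  -- As `F` is non-adjacency, such a set spans at least `tri v ∸ f` edges of the graph itself; a set
  -- with `f = 0` is a clique there.
  record Sparse (xs : List A) (v f : ℕ) : Set where
    constructor sparse
    field
      vertices : List A
      unique   : Unique vertices
      subset   : ∀ {x} → x ∈ vertices → x ∈ xs
      size     : length vertices ≡ v
      few      : edges vertices ≤ f

  whole : ∀ {xs v f} → Unique xs → length xs ≡ v → edges xs ≤ f → Sparse xs v f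
  whole {xs} u l e = sparse xs u id l e

  module _ {xs : List A} (tf : TriangleFree xs) where

    nbrs-independent : ∀ {u x y} → u ∈ xs → x ∈ nbrs u xs → y ∈ nbrs u xs → F x y ≡ true → ⊥
    nbrs-independent {u} u∈ x∈ y∈ xy with ∈-nbrs u xs x∈ | ∈-nbrs u xs y∈
    ... | x∈xs , ux | y∈xs , uy = tf u∈ x∈xs y∈xs ux uy xy

    sparse-nbrs : Unique xs → ∀ {u v} → u ∈ xs → v ≤ deg u xs → Sparse xs v 0
    sparse-nbrs uxs {u} {v} u∈ v≤ = sparse
      (take v (nbrs u xs))
      (Uniqueₚ.take⁺ v (Uniqueₚ.filter⁺ _ uxs))
      (λ p → proj₁ (∈-nbrs u xs (∈-take v _ p)))
      (trans (length-take v _) (trans (cong (v ⊓_) (length-nbrs u xs)) (m≤n⇒m⊓n≡m v≤)))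
      (≤-reflexive (edges≡0 _ (λ p q → nbrs-independent u∈ (∈-take v _ p) (∈-take v _ q))))

    -- An `F`-neighbourhood is `F`-independent by triangle-freeness. If no degree reaches half the
    -- number of vertices, the degree sum bounds `edges xs`. Half is written `suc h`, so the degrees
    -- are then at most `h`.
    sparse-even : Unique xs → ∀ h → length xs ≡ 2 * suc h →
      Sparse xs (suc h) 0 ⊎ Sparse xs (2 * suc h) (suc h * h)
    sparse-even uxs h len with ∃∈⊎∀∈ (λ x → suc h ≤? deg x xs) xs
    ... | inj₁ (u , u∈ , h<d) = inj₁ (sparse-nbrs uxs u∈ h<d)
    ... | inj₂ none = inj₂ (whole uxs len (*-cancelˡ-≤ 2 (begin
        2 * edges xs                ≡⟨ handshake xs ⟨
        total (λ x → deg x xs) xs   ≤⟨ total-≤ h xs (λ p → s≤s⁻¹ (≰⇒> (none p))) ⟩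
        length xs * h               ≡⟨ cong (_* h) len ⟩
        2 * suc h * h               ≡⟨ *-assoc 2 (suc h) h ⟩
        2 * (suc h * h)             ∎)))

    -- For w ∈ ys at most one of F x w, F y w holds, by triangle-freeness.
    deg+deg≤length : ∀ {x y} ys → x ∈ xs → y ∈ xs → (∀ {w} → w ∈ ys → w ∈ xs) →
      F y x ≡ true → deg x ys + deg y ys ≤ length ys
    deg+deg≤length {x} {y} ys x∈ y∈ ys⊆ yx = begin
      deg x ys + deg y ys                           ≡⟨ total-+ (λ w → ⟦ F x w ⟧) (λ w → ⟦ F y w ⟧) ys ⟨
      total (λ w → ⟦ F x w ⟧ + ⟦ F y w ⟧) ys        ≤⟨ total-≤ 1 ys one ⟩
      length ys * 1                                 ≡⟨ *-identityʳ _ ⟩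
      length ys                                     ∎
      where
      one : ∀ {w} → w ∈ ys → ⟦ F x w ⟧ + ⟦ F y w ⟧ ≤ 1
      one {w} w∈ with F x w in xw | F y w in yw
      ... | true  | true  = ⊥-elim (tf y∈ x∈ (ys⊆ w∈) yx yw xw)
      ... | true  | false = ≤-refl
      ... | false | true  = ≤-refl
      ... | false | false = z≤n

    -- Each of the `deg y as` neighbours of `y` in `as` misses all `deg y bs` neighbours of `y` in
    -- `bs`, since an edge between them would close a triangle.
    cross+deg*deg≤ : ∀ {y} as bs → y ∈ xs → (∀ {w} → w ∈ as → w ∈ xs) → (∀ {w} → w ∈ bs → w ∈ xs) →
      cross as bs + deg y as * deg y bs ≤ length as * length bs
    cross+deg*deg≤ {y} as bs y∈ as⊆ bs⊆ = begin
      cross as bs + deg y as * deg y bs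
        ≡⟨ cong (cross as bs +_) (total-*ʳ (λ w → ⟦ F y w ⟧) (deg y bs) as) ⟨
      cross as bs + total (λ x → ⟦ F y x ⟧ * deg y bs) as
        ≡⟨ total-+ (λ x → deg x bs) (λ x → ⟦ F y x ⟧ * deg y bs) as ⟨
      total (λ x → deg x bs + ⟦ F y x ⟧ * deg y bs) as
        ≤⟨ total-≤ (length bs) as one ⟩
      length as * length bs ∎
      where
      one : ∀ {x} → x ∈ as → deg x bs + ⟦ F y x ⟧ * deg y bs ≤ length bs
      one {x} x∈ with F y x in yx
      ... | true  rewrite +-identityʳ (deg y bs) = deg+deg≤length bs (as⊆ x∈) y∈ bs⊆ yx
      ... | false rewrite +-identityʳ (deg x bs) = deg≤length x bs

    -- The inequality is `f ≤ h² - h/2` without the fraction. The parameter `ρ` is the threshold for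
    -- having few `F`-neighbours on one side, later about `√(h/2)`.
    Outcome : ℕ → ℕ → Set
    Outcome h ρ = Sparse xs (suc h) (suc (2 * ρ)) ⊎ ∃[ f ] (2 * f + h ≤ 2 * (h * h) × Sparse xs (suc (2 * h)) f)

    -- Here `as` and `bs` are the cliques A and B of the plan, of sizes `h` and `h - 1`, and `y`,
    -- `z` are the two vertices left over.
    module Split (uxs : Unique xs) {h g : ℕ} (ρ : ℕ) (h≡1+g : h ≡ suc g) (ρ-large : 2 + h ≤ 2 * (ρ * ρ))
                 (len : length xs ≡ suc (2 * h)) (deg≤h : ∀ {x} → x ∈ xs → deg x xs ≤ h)
                 (as bs : List A) (y z : A) (split : xs ↭ as ++ bs ++ y ∷ z ∷ [])
                 (|as| : length as ≡ h) (|bs| : length bs ≡ g)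
                 (as-indep : edges as ≡ 0) (bs-indep : edges bs ≡ 0) where

      private
        u-all : Unique (as ++ bs ++ y ∷ z ∷ [])
        u-all = Unique-↭ split uxs

        ∈xs : ∀ {w} → w ∈ as ++ bs ++ y ∷ z ∷ [] → w ∈ xs
        ∈xs = ↭ₚ.∈-resp-↭ (↭-sym split)

        ∈xs-as : ∀ {w} → w ∈ as → w ∈ xs
        ∈xs-as = ∈xs ∘ ∈-++⁺ˡ

        ∈xs-bs : ∀ {w} → w ∈ bs → w ∈ xs
        ∈xs-bs = ∈xs ∘ ∈-++⁺ʳ as ∘ ∈-++⁺ˡ

        y∈ : y ∈ xs
        y∈ = ∈xs (∈-++⁺ʳ as (∈-++⁺ʳ bs (here refl)))

        z∈ : z ∈ xs
        z∈ = ∈xs (∈-++⁺ʳ as (∈-++⁺ʳ bs (there (here refl))))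

      z∷as : deg z as ≤ ρ → Outcome h ρ
      z∷as d≤ρ = inj₁ (sparse (z ∷ as)
        (Unique-++⁻ˡ (z ∷ as) (Unique-↭ (shape as) u-all))
        (λ { (here refl) → z∈ ; (there p) → ∈xs-as p })
        (cong suc |as|)
        (≤-trans (≤-reflexive (trans (cong (deg z as +_) as-indep) (+-identityʳ _)))
                 (≤-trans d≤ρ (≤-by (ρ + 1) (lemma ρ)))))
        where
        lemma : ∀ r → r + (r + 1) ≡ suc (2 * r)
        lemma = solve-∀
        shape : ∀ as → as ++ bs ++ y ∷ z ∷ [] ↭ (z ∷ as) ++ bs ++ y ∷ []
        shape as = ↭-trans (↭ₚ.++⁺ˡ as (↭-trans (↭ₚ.++⁺ˡ bs (_↭_.swap y z ↭-refl)) (↭ₚ.shift z bs (y ∷ []))))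
                           (↭ₚ.shift z as (bs ++ y ∷ []))

      -- This case dictates the bound `suc (2 * ρ)`: one for the possible edge `y z`, and `ρ` for
      -- each of `y` and `z`.
      y∷z∷bs : deg y bs ≤ ρ → deg z bs ≤ ρ → Outcome h ρ
      y∷z∷bs dy dz = inj₁ (sparse (y ∷ z ∷ bs)
        (Unique-↭ (↭ₚ.++-comm bs (y ∷ z ∷ [])) (Unique-++⁻ʳ as u-all))
        (λ { (here refl) → y∈ ; (there (here refl)) → z∈ ; (there (there p)) → ∈xs-bs p })
        (cong suc (trans (cong suc |bs|) (sym h≡1+g)))
        (begin
          ⟦ F y z ⟧ + deg y bs + (deg z bs + edges bs)
            ≡⟨ cong (λ e → ⟦ F y z ⟧ + deg y bs + (deg z bs + e)) bs-indep ⟩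
          ⟦ F y z ⟧ + deg y bs + (deg z bs + 0)
            ≤⟨ +-mono-≤ (+-mono-≤ (⟦⟧≤1 (F y z)) dy) (+-mono-≤ dz z≤n) ⟩
          1 + ρ + (ρ + 0) ∎))

      edges-split : edges xs ≡ cross as bs + (deg y as + (deg z as + 0)) +
                               (deg y bs + (deg z bs + 0) + ⟦ F y z ⟧)
      edges-split
        rewrite edges-↭ split | edges-++ as (bs ++ y ∷ z ∷ []) | as-indep
              | cross-sym as (bs ++ y ∷ z ∷ [])
              | total-++ (λ x → deg x as) bs (y ∷ z ∷ [])
              | cross-sym bs as
              | edges-++ bs (y ∷ z ∷ []) | bs-indep | cross-sym bs (y ∷ z ∷ [])
              | +-identityʳ ⟦ F y z ⟧ | +-identityʳ ⟦ F y z ⟧ = refl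

      deg-split : deg z as + (deg z bs + ⟦ F y z ⟧) ≤ h
      deg-split = ≤-trans (≤-reflexive (sym eq)) (deg≤h z∈)
        where
        eq : deg z xs ≡ deg z as + (deg z bs + ⟦ F y z ⟧)
        eq rewrite total-↭ (λ w → ⟦ F z w ⟧) split
                 | total-++ (λ w → ⟦ F z w ⟧) as (bs ++ y ∷ z ∷ [])
                 | total-++ (λ w → ⟦ F z w ⟧) bs (y ∷ z ∷ [])
                 | F-irrefl z | F-sym z y | +-identityʳ ⟦ F y z ⟧ = refl

      -- With degrees `a + 1` and `b + 1` of `y` into the two sides, at most
      -- `h (h - 1) - (a + 1)(b + 1)` edges run between the sides; `y` adds `a + b + 2` and `z`,
      -- together with the edge `y z`, at most `h`. The sum is `h² - a b + 1`, and
      -- `a b ≥ ρ² ≥ 1 + h/2` leaves at most `h² - h/2`.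
      dense : ρ < deg y as → ρ < deg y bs → Outcome h ρ
      dense ρ<a ρ<b with deg y as in eqa | deg y bs in eqb
      dense (s≤s ρ≤a) (s≤s ρ≤b) | suc a | suc b =
        inj₂ (edges xs , goal , whole uxs len ≤-refl)
        where
        c = cross as bs
        key : c + suc a * suc b ≤ h * g
        key = subst₂ _≤_ (cong₂ (λ p q → c + p * q) eqa eqb) (cong₂ _*_ |as| |bs|)
                (cross+deg*deg≤ as bs y∈ ∈xs-as ∈xs-bs)
        l₁ : ∀ c a b az bz f → c + (suc a + (az + 0)) + (suc b + (bz + 0) + f) ≡
                               c + suc a + suc b + (az + (bz + f))
        l₁ = solve-∀
        l₃ : ∀ g → 2 * (suc g * g + suc g) ≡ 2 * (suc g * suc g)
        l₃ = solve-∀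
        bound : edges xs ≤ c + suc a + suc b + h
        bound = begin
          edges xs ≡⟨ edges-split ⟩
          c + (deg y as + (deg z as + 0)) + (deg y bs + (deg z bs + 0) + ⟦ F y z ⟧)
            ≡⟨ cong₂ (λ p q → c + (p + (deg z as + 0)) + (q + (deg z bs + 0) + ⟦ F y z ⟧)) eqa eqb ⟩
          c + (suc a + (deg z as + 0)) + (suc b + (deg z bs + 0) + ⟦ F y z ⟧)
            ≡⟨ l₁ c a b (deg z as) (deg z bs) ⟦ F y z ⟧ ⟩
          c + suc a + suc b + (deg z as + (deg z bs + ⟦ F y z ⟧))
            ≤⟨ +-monoʳ-≤ _ deg-split ⟩
          c + suc a + suc b + h ∎
        goal : 2 * edges xs + h ≤ 2 * (h * h)
        goal = +-cancelʳ-≤ (2 * (ρ * ρ)) _ _ (begin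
          2 * edges xs + h + 2 * (ρ * ρ)
            ≤⟨ +-mono-≤ (+-monoˡ-≤ h (*-monoʳ-≤ 2 bound)) (*-monoʳ-≤ 2 (*-mono-≤ ρ≤a ρ≤b)) ⟩
          2 * (c + suc a + suc b + h) + h + 2 * (a * b)
            ≡⟨ l₂ c a b h ⟩
          2 * (c + suc a * suc b + h) + (2 + h)
            ≤⟨ +-mono-≤ (*-monoʳ-≤ 2 (+-monoˡ-≤ h key)) ρ-large ⟩
          2 * (h * g + h) + 2 * (ρ * ρ)
            ≡⟨ cong (λ k → 2 * (k * g + k) + 2 * (ρ * ρ)) h≡1+g ⟩
          2 * (suc g * g + suc g) + 2 * (ρ * ρ)
            ≡⟨ cong (_+ 2 * (ρ * ρ)) (l₃ g) ⟩
          2 * (suc g * suc g) + 2 * (ρ * ρ)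
            ≡⟨ cong (λ k → 2 * (k * k) + 2 * (ρ * ρ)) h≡1+g ⟨
          2 * (h * h) + 2 * (ρ * ρ) ∎)
          where
          l₂ : ∀ c a b h → 2 * (c + suc a + suc b + h) + h + 2 * (a * b) ≡ 2 * (c + suc a * suc b + h) + (2 + h)
          l₂ = solve-∀

    sparse-odd : Unique xs → ∀ h ρ → 2 + suc h ≤ 2 * (ρ * ρ) → length xs ≡ suc (2 * suc h) → Outcome (suc h) ρ
    sparse-odd uxs g ρ ρ-large len with ∃∈⊎∀∈ (λ x → 2 + g ≤? deg x xs) xs
    ... | inj₁ (u , u∈ , h<d) with sparse-nbrs uxs u∈ h<d
    ...   | sparse vs uq s l f = inj₁ (sparse vs uq s l (≤-trans f z≤n))
    sparse-odd uxs g ρ ρ-large len | inj₂ none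
      -- If `F` has at most `h² - h/2` edges, the whole vertex set is already an outcome; from here
      -- on `many` denies this.
      with 2 * edges xs + suc g ≤? 2 * (suc g * suc g)
    ... | yes few = inj₂ (edges xs , few , whole uxs len ≤-refl)
    ... | no many = conclude
      where
      h = suc g

      deg≤h : ∀ {x} → x ∈ xs → deg x xs ≤ h
      deg≤h x∈ = s≤s⁻¹ (≰⇒> (none x∈))

      -- If all degrees were at most `h - 1`, the degree sum would be at most
      -- `(2h + 1)(h - 1) = 2h² - h - 1`, against `many`.
      u-exists : ∃[ u ] (u ∈ xs × h ≤ deg u xs)
      u-exists with ∃∈⊎∀∈ (λ x → h ≤? deg x xs) xs
      ... | inj₁ p = p
      ... | inj₂ small = contradiction (begin
        2 * edges xs + h               ≡⟨ cong (_+ h) (handshake xs) ⟨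
        total (λ x → deg x xs) xs + h  ≤⟨ +-monoˡ-≤ h (total-≤ g xs (λ p → s≤s⁻¹ (≰⇒> (small p)))) ⟩
        length xs * g + h              ≡⟨ cong (λ l → l * g + h) len ⟩
        suc (2 * h) * g + h            ≤⟨ ≤-by 1 (lemma g) ⟩
        2 * (h * h)                    ∎) many
        where
        lemma : ∀ g → suc (2 * suc g) * g + suc g + 1 ≡ 2 * (suc g * suc g)
        lemma = solve-∀

      u = proj₁ u-exists
      u∈ = proj₁ (proj₂ u-exists)
      as = nbrs u xs
      rest = nonnbrs u xs

      split₁ : xs ↭ as ++ rest
      split₁ = nbrs-↭ u xs

      |as| : length as ≡ h
      |as| = trans (length-nbrs u xs) (≤-antisym (deg≤h u∈) (proj₂ (proj₂ u-exists)))

      |rest| : length rest ≡ suc h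
      |rest| = +-cancelˡ-≡ h _ _ (begin-equality
        h + length rest           ≡⟨ cong (_+ length rest) |as| ⟨
        length as + length rest   ≡⟨ length-++ as ⟨
        length (as ++ rest)       ≡⟨ ↭ₚ.↭-length split₁ ⟨
        length xs                 ≡⟨ len ⟩
        suc (2 * h)               ≡⟨ lemma h ⟩
        h + suc h                 ∎)
        where
        lemma : ∀ h → suc (2 * h) ≡ h + suc h
        lemma = solve-∀

      rest⊆ : ∀ {w} → w ∈ rest → w ∈ xs
      rest⊆ p = ↭ₚ.∈-resp-↭ (↭-sym split₁) (∈-++⁺ʳ as p)

      -- If the `h` neighbours of `u` all had degree at most `h - 2`, then, the other `h + 1`
      -- vertices having degree at most `h`, the degree sum would be at most
      -- `h (h - 2) + (h + 1) h = 2h² - h`, against `many`.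
      v-exists : ∃[ v ] (v ∈ as × g ≤ deg v xs)
      v-exists with ∃∈⊎∀∈ (λ x → g ≤? deg x xs) as
      ... | inj₁ p = p
      ... | inj₂ small = contradiction (begin
        2 * edges xs + h                                       ≡⟨ cong (_+ h) (handshake xs) ⟨
        total d xs + h                                         ≡⟨ cong (_+ h) (total-↭ d split₁) ⟩
        total d (as ++ rest) + h                               ≡⟨ cong (_+ h) (total-++ d as rest) ⟩
        total d as + total d rest + h                          ≡⟨ lemma₁ (total d as) (total d rest) h ⟩
        -- The summand `h` is spread over the `h` vertices of `as`, one for each, so that no `g ∸ 1`
        -- has to be written.
        h * 1 + total d as + total d rest
          ≡⟨ cong (λ l → l * 1 + total d as + total d rest) |as| ⟨
        length as * 1 + total d as + total d rest
          ≡⟨ cong (λ t → t + total d as + total d rest) (total-const 1 as) ⟨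
        total (λ _ → 1) as + total d as + total d rest         ≡⟨ cong (_+ total d rest) (total-+ (λ _ → 1) d as) ⟨
        total (suc ∘ d) as + total d rest
          ≤⟨ +-mono-≤ (total-≤ g as (λ p → ≰⇒> (small p))) (total-≤ h rest (deg≤h ∘ rest⊆)) ⟩
        length as * g + length rest * h                        ≡⟨ cong₂ (λ p q → p * g + q * h) |as| |rest| ⟩
        h * g + suc h * h                                      ≡⟨ lemma₂ g ⟩
        2 * (h * h)                                            ∎) many
        where
        d = λ x → deg x xs
        lemma₁ : ∀ a b c → a + b + c ≡ c * 1 + a + b
        lemma₁ = solve-∀
        lemma₂ : ∀ g → suc g * g + suc (suc g) * suc g ≡ 2 * (suc g * suc g)
        lemma₂ = solve-∀

      v = proj₁ v-exists
      v∈as = proj₁ (proj₂ v-exists)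
      v∈ = proj₁ (∈-nbrs u xs v∈as)

      -- No neighbour of `v` lies in the independent set `as`, so `v` has at least `g` neighbours in
      -- `rest`, and `bs` can be taken disjoint from `as`.
      deg-v-rest : deg v xs ≡ deg v rest
      deg-v-rest = trans (total-↭ _ split₁) (trans (total-++ _ as rest)
        (cong (_+ deg v rest) (deg≡0 v as (nbrs-independent u∈ v∈as))))

      bs = take g (nbrs v rest)
      others = drop g (nbrs v rest) ++ nonnbrs v rest

      split₂ : rest ↭ bs ++ others
      split₂ = ↭-trans (nbrs-↭ v rest)
        (↭-trans (↭-reflexive (cong (_++ nonnbrs v rest) (sym (take++drop≡id g (nbrs v rest)))))
                 (↭ₚ.++-assoc bs _ _))

      |bs| : length bs ≡ g
      |bs| = trans (length-take g _) (trans (cong (g ⊓_) (trans (length-nbrs v rest) (sym deg-v-rest)))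
                                            (m≤n⇒m⊓n≡m (proj₂ (proj₂ v-exists))))

      |others| : length others ≡ 2
      |others| = +-cancelˡ-≡ g _ _ (begin-equality
        g + length others           ≡⟨ cong (_+ length others) |bs| ⟨
        length bs + length others   ≡⟨ length-++ bs ⟨
        length (bs ++ others)       ≡⟨ ↭ₚ.↭-length split₂ ⟨
        length rest                 ≡⟨ |rest| ⟩
        suc (suc g)                 ≡⟨ +-comm 2 g ⟩
        g + 2                       ∎)

      as-indep : edges as ≡ 0
      as-indep = edges≡0 as (nbrs-independent u∈)

      bs⊆ : ∀ {w} → w ∈ bs → w ∈ nbrs v xs
      bs⊆ p with ∈-nbrs v rest (∈-take g _ p)
      ... | w∈ , vw = ∈-filter⁺ (λ y → F v y Boolₚ.≟ true) (rest⊆ w∈) vw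

      bs-indep : edges bs ≡ 0
      bs-indep = edges≡0 bs (λ p q → nbrs-independent v∈ (bs⊆ p) (bs⊆ q))

      conclude : Outcome h ρ
      conclude with others in eq | |others|
      ... | y ∷ z ∷ [] | _ = cases
        where
        split₃ : xs ↭ as ++ bs ++ y ∷ z ∷ []
        split₃ = ↭-trans split₁ (↭ₚ.++⁺ˡ as (↭-trans split₂ (↭-reflexive (cong (bs ++_) eq))))
        swapped : xs ↭ as ++ bs ++ z ∷ y ∷ []
        swapped = ↭-trans split₃ (↭ₚ.++⁺ˡ as (↭ₚ.++⁺ˡ bs (_↭_.swap y z ↭-refl)))
        module yz = Split uxs ρ refl ρ-large len deg≤h as bs y z split₃ |as| |bs| as-indep bs-indep
        module zy = Split uxs ρ refl ρ-large len deg≤h as bs z y swapped |as| |bs| as-indep bs-indep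
        cases : Outcome h ρ
        -- Once both `y` and `z` exceed `ρ` into `as`, either both are below the threshold into
        -- `bs`, or one of them exceeds it on both sides. The roles of `y` and `z` are exchanged
        -- through `swapped`.
        cases with deg z as ≤? ρ | deg y as ≤? ρ | deg y bs ≤? ρ | deg z bs ≤? ρ
        ... | yes p | _     | _     | _     = yz.z∷as p
        ... | no _  | yes p | _     | _     = zy.z∷as p
        ... | no p  | no q  | yes r | yes s = yz.y∷z∷bs r s
        ... | no p  | no q  | no r  | _     = yz.dense (≰⇒> q) (≰⇒> r)
        ... | no p  | no q  | yes _ | no s  = zy.dense (≰⇒> p) (≰⇒> s)

-- Dense subgraphs from the exponent hypothesis

-- This provides the integer parts of square roots, `q`-th roots, logarithms and quotients that the
-- choice of parameters needs.
last-true : ∀ {P : ℕ → Set} → Decidable P → P 0 → ∀ b → ¬ P b → ∃[ k ] (P k × ¬ P (suc k))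
last-true P? p0 zero    ¬pb = contradiction p0 ¬pb
last-true P? p0 (suc b) ¬pb with P? b
... | yes pb = b , pb , ¬pb
... | no ¬pb′ = last-true P? p0 b ¬pb′

-- The binomial coefficient `v` choose 2.
tri : ℕ → ℕ
tri zero    = 0
tri (suc v) = v + tri v

2*tri : ∀ v → 2 * tri (suc v) ≡ suc v * v
2*tri zero    = refl
2*tri (suc v) = trans (*-distribˡ-+ 2 (suc v) (tri (suc v)))
                      (trans (cong (2 * suc v +_) (2*tri v)) (lemma v))
  where
  lemma : ∀ v → 2 * suc v + suc v * v ≡ suc (suc v) * suc v
  lemma = solve-∀

exponent-cases : ∀ {m p q} → ExponentAbove m p q →
  (∃[ h ] (m ≡ 2 * h × 4 * q < p * (m + 2))) ⊎
  (∃[ h ] (m ≡ suc (2 * h) × 4 * q < p * (m + 3) ×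
    169 * (p * p) < ((p * (m + 3)) ∸ (4 * q)) * ((p * (m + 3)) ∸ (4 * q)) * m))
exponent-cases {m} ex with m % 2 | m≡m%n+[m/n]*n m 2 | m%n<n m 2
... | 0 | eq | _ = inj₁ (m / 2 , trans eq (*-comm (m / 2) 2) , ex)
... | 1 | eq | _ = inj₂ (m / 2 , trans eq (cong suc (*-comm (m / 2) 2)) , ex)
... | suc (suc _) | _ | s≤s (s≤s ())

module Exponent (p q : ℕ) where

  -- About `n^(v-2)` sets of `v` vertices contain a given pair, and the other `e - 1` edges appear
  -- with probability about `n^(-(p/q)(e-1))`, up to logarithms. The inequality makes the product a
  -- negative power of `n`.
  Good : ℕ → ℕ → Set
  Good v e = q * (v ∸ 2) < p * (e ∸ 1)

  Good-mono : ∀ v {e e′} → e ≤ e′ → Good v e → Good v e′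
  Good-mono v e≤e′ g = <-≤-trans g (*-monoʳ-≤ p (∸-monoˡ-≤ 1 e≤e′))

  private
    4e≥ : ∀ w f → 2 * (suc (suc w) * suc w) ≤ 4 * (tri (2 + w) ∸ f ∸ 1) + 4 + 4 * f
    4e≥ w f = begin
      2 * (suc (suc w) * suc w)  ≡⟨ cong (2 *_) (2*tri (suc w)) ⟨
      2 * (2 * t)                ≡⟨ *-assoc 2 2 t ⟨
      4 * t                      ≤⟨ *-monoʳ-≤ 4 (m≤n+m∸n t f) ⟩
      4 * (f + (t ∸ f))          ≤⟨ *-monoʳ-≤ 4 (+-monoʳ-≤ f (m≤n+m∸n (t ∸ f) 1)) ⟩
      4 * (f + (1 + e))          ≡⟨ lemma f e ⟩
      4 * e + 4 + 4 * f          ∎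
      where
      t = tri (2 + w)
      e = t ∸ f ∸ 1
      lemma : ∀ f e → 4 * (f + (1 + e)) ≡ 4 * e + 4 + 4 * f
      lemma = solve-∀

    drop-4f : ∀ w f d x → x + 4 + 4 * f ≤ 2 * (suc (suc w) * suc w) + d →
              x ≤ 4 * (tri (2 + w) ∸ f ∸ 1) + d
    drop-4f w f d x le = +-cancelʳ-≤ (4 + 4 * f) _ _ (begin
      x + (4 + 4 * f)                     ≡⟨ +-assoc x 4 (4 * f) ⟨
      x + 4 + 4 * f                       ≤⟨ le ⟩
      2 * (suc (suc w) * suc w) + d       ≤⟨ +-monoˡ-≤ d (4e≥ w f) ⟩
      4 * e + 4 + 4 * f + d               ≡⟨ lemma e (4 * f) d ⟩
      4 * e + d + (4 + 4 * f)             ∎)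
      where
      e = tri (2 + w) ∸ f ∸ 1
      lemma : ∀ e f d → 4 * e + 4 + f + d ≡ 4 * e + d + (4 + f)
      lemma = solve-∀

  -- For `v = 2 + w` and `e = tri v - f` the last hypothesis reads `(m + 2)(v - 2) ≤ 4 (e - 1)`;
  -- multiplied by `p` it is combined with `4 q < p (m + 2)`.
  good-even : ∀ m w f → 4 * q < p * (m + 2) → 0 < w →
    (m + 2) * w + 4 + 4 * f ≤ 2 * (suc (suc w) * suc w) → Good (2 + w) (tri (2 + w) ∸ f)
  good-even m w f ex 0<w le = *-cancelˡ-< 4 _ _ (begin-strict
    4 * (q * w)        ≡⟨ *-assoc 4 q w ⟨
    4 * q * w          <⟨ *-monoˡ-< w {{>-nonZero 0<w}} ex ⟩
    p * (m + 2) * w    ≡⟨ *-assoc p (m + 2) w ⟩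
    p * ((m + 2) * w)  ≤⟨ *-monoʳ-≤ p (drop-4f w f 0 _ (≤-trans le (m≤m+n _ 0))) ⟩
    p * (4 * e + 0)    ≡⟨ lemma p e ⟩
    4 * (p * e)        ∎)
    where
    e = tri (2 + w) ∸ f ∸ 1
    lemma : ∀ p e → p * (4 * e + 0) ≡ 4 * (p * e)
    lemma = solve-∀

  module Odd {m : ℕ} (ex₁ : 4 * q < p * (m + 3))
             (ex₂ : 169 * (p * p) < ((p * (m + 3)) ∸ (4 * q)) * ((p * (m + 3)) ∸ (4 * q)) * m) where

    X : ℕ
    X = p * (m + 3) ∸ 4 * q

    -- d is the deficit of 4 (e − 1) from (v − 2)(m + 3); it may reach 13 (v − 2) / √m.
    good-odd : ∀ w f d → 0 < w → m * (d * d) ≤ 169 * (w * w) →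
      (m + 3) * w + 4 + 4 * f ≤ 2 * (suc (suc w) * suc w) + d → Good (2 + w) (tri (2 + w) ∸ f)
    good-odd w f d 0<w d-small le = *-cancelˡ-< 4 _ _ (+-cancelʳ-< (X * w) _ _ (begin-strict
      4 * (q * w) + X * w         ≡⟨ lemma₁ q w X ⟩
      (4 * q + X) * w             ≡⟨ cong (_* w) (m+[n∸m]≡n (<⇒≤ ex₁)) ⟩
      p * (m + 3) * w             ≡⟨ *-assoc p (m + 3) w ⟩
      p * ((m + 3) * w)           ≤⟨ *-monoʳ-≤ p (drop-4f w f d _ le) ⟩
      p * (4 * e + d)             ≡⟨ lemma₂ p e d ⟩
      4 * (p * e) + p * d         <⟨ +-monoʳ-< (4 * (p * e)) pd<Xw ⟩
      4 * (p * e) + X * w         ∎))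
      where
      e = tri (2 + w) ∸ f ∸ 1
      lemma₁ : ∀ q w x → 4 * (q * w) + x * w ≡ (4 * q + x) * w
      lemma₁ = solve-∀
      lemma₂ : ∀ p e d → p * (4 * e + d) ≡ 4 * (p * e) + p * d
      lemma₂ = solve-∀
      lemma₃ : ∀ x w m → x * x * m * (w * w) ≡ (x * w) * (x * w) * m
      lemma₃ = solve-∀
      lemma₄ : ∀ p d m → (p * d) * (p * d) * m ≡ p * p * (m * (d * d))
      lemma₄ = solve-∀
      lemma₅ : ∀ p w → p * p * (169 * (w * w)) ≡ 169 * (p * p) * (w * w)
      lemma₅ = solve-∀
      pd<Xw : p * d < X * w
      -- The hypothesis knows `13 / √m` only through its square, so `p d` and `X w` are compared
      -- after squaring and multiplying by `m`.
      pd<Xw = ≰⇒> λ Xw≤pd → <-irrefl refl (begin-strict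
        169 * (p * p) * (w * w)
          <⟨ *-monoˡ-< (w * w) {{>-nonZero (*-mono-≤ 0<w 0<w)}} ex₂ ⟩
        X * X * m * (w * w)          ≡⟨ lemma₃ X w m ⟩
        (X * w) * (X * w) * m        ≤⟨ *-monoˡ-≤ m (*-mono-≤ Xw≤pd Xw≤pd) ⟩
        (p * d) * (p * d) * m        ≡⟨ lemma₄ p d m ⟩
        p * p * (m * (d * d))        ≤⟨ *-monoʳ-≤ (p * p) d-small ⟩
        p * p * (169 * (w * w))      ≡⟨ lemma₅ p w ⟩
        169 * (p * p) * (w * w)      ∎)

module _ where
  private
    -- To leading order this compares `8 σ²` with `10 c`, where `10 c ≥ 20 σ² - 40`. The lower-order
    -- terms fit only from `σ = 4` on; below that, `c ≥ 18` decides numerically.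
    square-bound : ∀ σ c → 2 * (σ * σ) ≤ 4 + c → 18 ≤ c → 2 * ((2 * σ + 3) * (2 * σ + 3)) ≤ 5 * suc (2 * c)
    square-bound σ c σ≤ c≥18 with 4 ≤? σ
    ... | no σ≱4 = begin
      2 * ((2 * σ + 3) * (2 * σ + 3))  ≤⟨ *-monoʳ-≤ 2 (*-mono-≤ 2σ+3≤9 2σ+3≤9) ⟩
      162                              ≤⟨ ≤-by {162} {185} 23 refl ⟩
      185                              ≤⟨ *-monoʳ-≤ 5 (s≤s (*-monoʳ-≤ 2 c≥18)) ⟩
      5 * suc (2 * c)                  ∎
      where
      2σ+3≤9 : 2 * σ + 3 ≤ 9
      2σ+3≤9 = +-monoˡ-≤ 3 (*-monoʳ-≤ 2 (s≤s⁻¹ (≰⇒> σ≱4)))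
    ... | yes σ≥4 with m≤n⇒∃[o]m+o≡n σ≥4
    ...   | b , refl = +-cancelʳ-≤ 35 _ _ (begin
      2 * ((2 * (4 + b) + 3) * (2 * (4 + b) + 3)) + 35   ≤⟨ ≤-by _ (lemma₁ b) ⟩
      10 * (2 * ((4 + b) * (4 + b)))                     ≤⟨ *-monoʳ-≤ 10 σ≤ ⟩
      10 * (4 + c)                                       ≡⟨ lemma₂ c ⟩
      5 * suc (2 * c) + 35                               ∎)
      where
      lemma₁ : ∀ b → 2 * ((2 * (4 + b) + 3) * (2 * (4 + b) + 3)) + 35 + (43 + 72 * b + 12 * (b * b)) ≡
                     10 * (2 * ((4 + b) * (4 + b)))
      lemma₁ = solve-∀
      lemma₂ : ∀ c → 10 * (4 + c) ≡ 5 * suc (2 * c) + 35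
      lemma₂ = solve-∀

    -- As `8 (σ + 1) + 4 = 4 (2 σ + 3)`, the previous bound yields the factor `160 = 32 · 5`, and
    -- `(2c + 7)(2c + 1) ≤ 4 (c + 2)²` does the rest.
    scaled : ∀ k → 160 ≤ k → ∀ σ c → 2 * (σ * σ) ≤ 4 + c → 18 ≤ c →
      suc (2 * (3 + c)) * ((8 * suc σ + 4) * (8 * suc σ + 4)) ≤ k * ((2 + c) * (2 + c))
    scaled k 160≤k σ c σ≤ c≥18 = *-cancelˡ-≤ 4 (begin
      4 * (m * ((8 * suc σ + 4) * (8 * suc σ + 4)))     ≡⟨ lemma₁ m σ ⟩
      m * (32 * (2 * ((2 * σ + 3) * (2 * σ + 3))))      ≤⟨ *-monoʳ-≤ m (*-monoʳ-≤ 32 (square-bound σ c σ≤ c≥18)) ⟩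
      m * (32 * (5 * suc (2 * c)))                      ≡⟨ cong (m *_) (*-assoc 32 5 (suc (2 * c))) ⟨
      m * (160 * suc (2 * c))                           ≤⟨ *-monoʳ-≤ m (*-monoˡ-≤ (suc (2 * c)) 160≤k) ⟩
      m * (k * suc (2 * c))                             ≤⟨ ≤-by _ (lemma₂ k c) ⟩
      4 * (k * ((2 + c) * (2 + c)))                     ∎)
      where
      m = suc (2 * (3 + c))
      lemma₁ : ∀ m s → 4 * (m * ((8 * suc s + 4) * (8 * suc s + 4))) ≡ m * (32 * (2 * ((2 * s + 3) * (2 * s + 3))))
      lemma₁ = solve-∀
      lemma₂ : ∀ k c → suc (2 * (3 + c)) * (k * suc (2 * c)) + k * 9 ≡ 4 * (k * ((2 + c) * (2 + c)))
      lemma₂ = solve-∀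

  -- The constant 13 enters here: with h = b + 1 and ρ = σ + 1 ≈ √(h/2), the deficit
  -- 8 ρ + 4 is at most 13 (h - 1) / √(2 h + 1) as soon as h ≥ 21.
  deficit-bound : ∀ σ b → 2 * (σ * σ) ≤ 2 + b → 20 ≤ b →
    suc (2 * suc b) * ((8 * suc σ + 4) * (8 * suc σ + 4)) ≤ 169 * (b * b)
  deficit-bound σ (suc (suc c)) σ≤ (s≤s (s≤s c≥18)) = scaled 169 (≤-by {160} 9 refl) σ c σ≤ c≥18

module Dense {A : Set} (F : A → A → Bool) (F-sym : ∀ x y → F x y ≡ F y x)
             (F-irrefl : ∀ x → F x x ≡ false) (p q : ℕ) where

  open Symmetric F F-sym F-irrefl
  open Exponent p q

  DenseSubgraph : List A → Set
  DenseSubgraph xs = ∃[ v ] ∃[ f ] (Sparse xs v f × Good v (tri v ∸ f))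

  module _ {xs : List A} (tf : TriangleFree xs) (uxs : Unique xs) where

    -- Both outcomes of `sparse-even` satisfy `(m + 2)(v - 2) = 4 (e - 1)` exactly, with `e` the
    -- guaranteed number of edges; this is the source of the denominator `m + 2`.
    dense-even : ∀ a → let h = 3 + a in 4 * q < p * (2 * h + 2) → length xs ≡ 2 * h → DenseSubgraph xs
    dense-even a ex len with sparse-even tf uxs (2 + a) len
    ... | inj₁ s = 3 + a , 0 , s , good-even (2 * (3 + a)) (1 + a) 0 ex (s≤s z≤n) (≤-reflexive (lemma a))
      where
      lemma : ∀ a → (2 * (3 + a) + 2) * (1 + a) + 4 + 0 ≡ 2 * ((3 + a) * (2 + a))
      lemma = solve-∀
    ... | inj₂ s = 2 * (3 + a) , (3 + a) * (2 + a) , s ,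
      subst (λ v → Good v (tri v ∸ (3 + a) * (2 + a))) (shape a)
        (good-even (2 * (3 + a)) (2 * (2 + a)) ((3 + a) * (2 + a)) ex (s≤s z≤n) (≤-reflexive (lemma a)))
      where
      shape : ∀ a → 2 + 2 * (2 + a) ≡ 2 * (3 + a)
      shape = solve-∀
      lemma : ∀ a → (2 * (3 + a) + 2) * (2 * (2 + a)) + 4 + 4 * ((3 + a) * (2 + a)) ≡
                    2 * ((2 + 2 * (2 + a)) * (1 + 2 * (2 + a)))
      lemma = solve-∀

    module _ {h : ℕ} (ex₁ : 4 * q < p * (suc (2 * h) + 3))
             (ex₂ : 169 * (p * p) < ((p * (suc (2 * h) + 3)) ∸ (4 * q)) * ((p * (suc (2 * h) + 3)) ∸ (4 * q)) * suc (2 * h)) where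

      open Odd ex₁ ex₂

      -- One vertex is dropped and the even case applied to `m - 1`. Its denominator `m + 1` is 2
      -- less than `m + 3`, a deficit of `2 (v - 2)`, which is allowed while `4 m ≤ 169`; here
      -- `m ≤ 41`.
      dense-odd-small : ∀ a → h ≡ 3 + a → h ≤ 20 → length xs ≡ suc (2 * h) → DenseSubgraph xs
      dense-odd-small a refl h≤20 len =
        widen (sparse-even tf′ (Uniqueₚ.take⁺ (2 * h) uxs) (2 + a)
                (trans (length-take (2 * h) xs) (trans (cong (2 * h ⊓_) len) (m≤n⇒m⊓n≡m (n≤1+n (2 * h))))))
        where
        tf′ : TriangleFree (take (2 * h) xs)
        tf′ x y z = tf (∈-take (2 * h) xs x) (∈-take (2 * h) xs y) (∈-take (2 * h) xs z)
        sub : ∀ {v f} → Sparse (take (2 * h) xs) v f → Sparse xs v f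
        sub (sparse vs u s l f) = sparse vs u (∈-take (2 * h) xs ∘ s) l f
        m≤42 : suc (2 * h) * 4 ≤ 169
        m≤42 = ≤-trans (*-monoˡ-≤ 4 (s≤s (*-monoʳ-≤ 2 h≤20))) (≤-by 5 refl)
        deficit : ∀ w → suc (2 * h) * ((2 * w) * (2 * w)) ≤ 169 * (w * w)
        deficit w = ≤-trans (≤-reflexive (lemma (suc (2 * h)) w)) (*-monoˡ-≤ (w * w) m≤42)
          where
          lemma : ∀ m w → m * ((2 * w) * (2 * w)) ≡ m * 4 * (w * w)
          lemma = solve-∀
        lemma₁ : ∀ a → (suc (2 * (3 + a)) + 3) * (1 + a) + 4 + 0 ≡ 2 * ((3 + a) * (2 + a)) + 2 * (1 + a)
        lemma₁ = solve-∀
        shape : ∀ a → 2 + 2 * (2 + a) ≡ 2 * (3 + a)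
        shape = solve-∀
        lemma₂ : ∀ a → (suc (2 * (3 + a)) + 3) * (2 * (2 + a)) + 4 + 4 * ((3 + a) * (2 + a)) ≡
                       2 * ((2 + 2 * (2 + a)) * (1 + 2 * (2 + a))) + 2 * (2 * (2 + a))
        lemma₂ = solve-∀
        widen : Sparse (take (2 * h) xs) (3 + a) 0 ⊎ Sparse (take (2 * h) xs) (2 * (3 + a)) ((3 + a) * (2 + a)) →
                DenseSubgraph xs
        widen (inj₁ s) = 3 + a , 0 , sub s ,
          good-odd (1 + a) 0 (2 * (1 + a)) (s≤s z≤n) (deficit (1 + a)) (≤-reflexive (lemma₁ a))
        widen (inj₂ s) = 2 * (3 + a) , (3 + a) * (2 + a) , sub s ,
          subst (λ v → Good v (tri v ∸ (3 + a) * (2 + a))) (shape a)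
            (good-odd (2 * (2 + a)) ((3 + a) * (2 + a)) (2 * (2 * (2 + a))) (s≤s z≤n) (deficit (2 * (2 + a))) (≤-reflexive (lemma₂ a)))

      dense-odd-large : ∀ b → h ≡ suc b → 20 ≤ b → length xs ≡ suc (2 * h) → DenseSubgraph xs
      dense-odd-large b refl 20≤b len
        -- The test holds at `σ` and fails at `ρ = σ + 1`, so `ρ` is about `√(h/2)` and
        -- `2 ρ² ≥ h + 2`, as `sparse-odd` requires.
        with last-true (λ σ → 2 * (σ * σ) <? 2 + h) (s≤s z≤n) (2 + h)
               (≤⇒≯ (≤-trans (m≤m*n (2 + h) (2 + h)) (m≤n*m _ 2)))
      ... | σ , σ-small , ρ-large
        with sparse-odd tf uxs b (suc σ) (≮⇒≥ ρ-large) len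
      -- A clique on `h + 1` vertices would give `(m + 3)(v - 2) = 4 (e - 1)`; the `2 ρ + 1`
      -- possibly missing edges cost `4 (2 ρ + 1) = 8 ρ + 4`.
      ...   | inj₁ s = 2 + b , suc (2 * suc σ) , s ,
        good-odd b (suc (2 * suc σ)) (8 * suc σ + 4) (≤-trans (s≤s z≤n) 20≤b) (deficit-bound σ b (s≤s⁻¹ σ-small) 20≤b)
          (≤-reflexive (lemma b (suc σ)))
        where
        lemma : ∀ b r → (suc (2 * suc b) + 3) * b + 4 + 4 * suc (2 * r) ≡
                        2 * (suc (suc b) * suc b) + (8 * r + 4)
        lemma = solve-∀
      -- On the whole vertex set, `f ≤ h² - h/2` is just what `(m + 3)(v - 2) ≤ 4 (e - 1)` asks for,
      -- so the deficit is 0.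
      ...   | inj₂ (f , f-small , s) = suc (2 * h) , f , s ,
        subst (λ v → Good v (tri v ∸ f)) (shape b)
          (good-odd (2 * b + 1) f 0 (m≤n+m 1 (2 * b))
            (≤-trans (≤-reflexive (*-zeroʳ (suc (2 * h)))) z≤n) le)
        where
        shape : ∀ b → 2 + (2 * b + 1) ≡ suc (2 * suc b)
        shape = solve-∀
        lemma₁ : ∀ b f → (suc (2 * suc b) + 3) * (2 * b + 1) + 4 + 4 * f ≡
                         2 * (2 * f + suc b) + (4 * (suc b * suc b) + 4 * suc b)
        lemma₁ = solve-∀
        lemma₂ : ∀ b → 2 * (2 * (suc b * suc b)) + (4 * (suc b * suc b) + 4 * suc b) ≡
                       2 * ((2 + (2 * b + 1)) * (1 + (2 * b + 1))) + 0
        lemma₂ = solve-∀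
        le : (suc (2 * h) + 3) * (2 * b + 1) + 4 + 4 * f ≤ 2 * ((2 + (2 * b + 1)) * (1 + (2 * b + 1))) + 0
        le = begin
          (suc (2 * h) + 3) * (2 * b + 1) + 4 + 4 * f             ≡⟨ lemma₁ b f ⟩
          2 * (2 * f + h) + (4 * (h * h) + 4 * h)                 ≤⟨ +-monoˡ-≤ _ (*-monoʳ-≤ 2 f-small) ⟩
          2 * (2 * (h * h)) + (4 * (h * h) + 4 * h)               ≡⟨ lemma₂ b ⟩
          2 * ((2 + (2 * b + 1)) * (1 + (2 * b + 1))) + 0         ∎

    -- For `m = 5` the denominator `8 - 13/√5` is below 4, so every admissible exponent exceeds 1.
    exponent<1⇒m≢5 : p < q → ¬ (169 * (p * p) < ((p * 8) ∸ (4 * q)) * ((p * 8) ∸ (4 * q)) * 5)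
    exponent<1⇒m≢5 p<q ex = <-irrefl refl (begin-strict
      169 * (p * p)             <⟨ ex ⟩
      (p * 8 ∸ 4 * q) * (p * 8 ∸ 4 * q) * 5   ≤⟨ *-monoˡ-≤ 5 (*-mono-≤ X≤4p X≤4p) ⟩
      4 * p * (4 * p) * 5       ≡⟨ lemma₁ p ⟩
      80 * (p * p)              ≤⟨ *-monoˡ-≤ (p * p) (≤-by {80} 89 refl) ⟩
      169 * (p * p)             ∎)
      where
      lemma₁ : ∀ p → 4 * p * (4 * p) * 5 ≡ 80 * (p * p)
      lemma₁ = solve-∀
      lemma₂ : ∀ p → p * 8 ≡ 4 * p + 4 * p
      lemma₂ = solve-∀
      X≤4p : p * 8 ∸ 4 * q ≤ 4 * p
      X≤4p = m≤n+o⇒m∸n≤o (p * 8) (4 * q) (begin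
        p * 8          ≡⟨ lemma₂ p ⟩
        4 * p + 4 * p  ≤⟨ +-monoˡ-≤ (4 * p) (*-monoʳ-≤ 4 (<⇒≤ p<q)) ⟩
        4 * q + 4 * p  ∎)

    dense-subgraph : ∀ {m} → 5 ≤ m → ExponentAbove m p q → p < q → length xs ≡ m → DenseSubgraph xs
    dense-subgraph {m} 5≤m ex p<q len with exponent-cases {m} ex
    ... | inj₁ (0 , refl , _) = contradiction 5≤m λ ()
    ... | inj₁ (1 , refl , _) = contradiction 5≤m λ { (s≤s (s≤s ())) }
    ... | inj₁ (2 , refl , _) = contradiction 5≤m λ { (s≤s (s≤s (s≤s (s≤s ())))) }
    ... | inj₁ (suc (suc (suc a)) , refl , ex₁) = dense-even a ex₁ len
    ... | inj₂ (0 , refl , _) = contradiction 5≤m λ { (s≤s ()) }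
    ... | inj₂ (1 , refl , _) = contradiction 5≤m λ { (s≤s (s≤s (s≤s ()))) }
    ... | inj₂ (2 , refl , _ , ex₂) = contradiction ex₂ (exponent<1⇒m≢5 p<q)
    ... | inj₂ (h@(suc (suc (suc a))) , refl , ex₁ , ex₂) with h ≤? 20
    ...   | yes h≤20 = dense-odd-small ex₁ ex₂ a refl h≤20 len
    ...   | no h≰20 = dense-odd-large ex₁ ex₂ (2 + a) refl (s≤s⁻¹ (≰⇒> h≰20)) len

-- The deletion method for an abstract set system

total-concatMap : ∀ {A B : Set} (w : B → ℕ) (f : A → List B) xs →
  total w (concatMap f xs) ≡ total (total w ∘ f) xs
total-concatMap w f []       = refl
total-concatMap w f (x ∷ xs) =
  trans (total-++ w (f x) (concatMap f xs)) (cong (total w (f x) +_) (total-concatMap w f xs))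

-- A state describes a cylinder of random sets: `chosen` elements are in, `rejected` ones out,
-- `idle` ones free, and `pending` ones belong to the set `T` under study and still have to be
-- explained.
data Cell : Set where
  chosen rejected pending idle : Cell

State : ℕ → Set
State = Vec Cell

fits : Bool → Cell → Bool
fits b chosen   = b
fits b rejected = not b
fits b pending  = true
fits b idle     = true

Compatible : ∀ {N} → Vec Bool N → State N → Set
Compatible G σ = ∀ i → fits (lookup G i) (lookup σ i) ≡ true

NoPending : ∀ {N} → State N → Set
NoPending σ = ∀ i → lookup σ i ≢ pending

module _ {N : ℕ} where

  mark : Cell → List (Fin N) → State N → State N
  mark c xs σ = foldr (λ x τ → τ [ x ]≔ c) σ xs

  lookup-mark-∈ : ∀ c {xs} σ {i} → i ∈ xs → lookup (mark c xs σ) i ≡ c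
  lookup-mark-∈ c {x ∷ xs} σ {i} i∈ with i Finₚ.≟ x
  ... | yes refl = lookup∘update x (mark c xs σ) c
  lookup-mark-∈ c {x ∷ xs} σ {i} (here i≡x) | no i≢x = contradiction i≡x i≢x
  lookup-mark-∈ c {x ∷ xs} σ {i} (there i∈) | no i≢x =
    trans (lookup∘update′ i≢x (mark c xs σ) c) (lookup-mark-∈ c σ i∈)

  lookup-mark-∉ : ∀ c {xs} σ {i} → i ∉ xs → lookup (mark c xs σ) i ≡ lookup σ i
  lookup-mark-∉ c {[]}     σ i∉ = refl
  lookup-mark-∉ c {x ∷ xs} σ i∉ =
    trans (lookup∘update′ (i∉ ∘ here) (mark c xs σ) c) (lookup-mark-∉ c σ (i∉ ∘ there))

-- An element is chosen with probability 1/(L+1).  A pending element has the weight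
-- 2L + 1 rather than 2L + 2: it must be rejected or covered by a chosen copy, and
-- the copies through it have total probability at most that of half a choice.
module Weighted (L : ℕ) where

  cell-weight : Cell → ℕ
  cell-weight chosen   = 2
  cell-weight rejected = 2 * L
  cell-weight pending  = 1 + 2 * L
  cell-weight idle     = 2 + 2 * L

  weight : ∀ {N} → State N → ℕ
  weight []      = 1
  weight (c ∷ σ) = cell-weight c * weight σ

  weight-idle : ∀ N → weight (replicate N idle) ≡ (2 + 2 * L) ^ N
  weight-idle zero    = refl
  weight-idle (suc N) = cong ((2 + 2 * L) *_) (weight-idle N)

  weight-update : ∀ {N} (σ : State N) i c →
    cell-weight (lookup σ i) * weight (σ [ i ]≔ c) ≡ cell-weight c * weight σ
  weight-update (d ∷ σ) zero    c = lemma (cell-weight d) (cell-weight c) (weight σ)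
    where
    lemma : ∀ a b w → a * (b * w) ≡ b * (a * w)
    lemma = solve-∀
  weight-update (d ∷ σ) (suc i) c =
    trans (lemma (cell-weight (lookup σ i)) (cell-weight d) _)
      (trans (cong (cell-weight d *_) (weight-update σ i c)) (lemma (cell-weight d) (cell-weight c) (weight σ)))
    where
    lemma : ∀ a b w → a * (b * w) ≡ b * (a * w)
    lemma = solve-∀

  restrict : ∀ {N} → Bool → List (State (suc N)) → List (State N)
  restrict b []             = []
  restrict b ((c ∷ σ) ∷ σs) = if fits b c then σ ∷ restrict b σs else restrict b σs

  ∈-restrict : ∀ {N} b {c} {σ : State N} σs → (c ∷ σ) ∈ σs → fits b c ≡ true → σ ∈ restrict b σs
  ∈-restrict b ((c ∷ σ) ∷ σs) (here refl) eq rewrite eq = here refl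
  ∈-restrict b ((d ∷ τ) ∷ σs) (there σ∈)  eq with fits b d
  ... | true  = there (∈-restrict b σs σ∈ eq)
  ... | false = ∈-restrict b σs σ∈ eq

  ∈-restrict⁻ : ∀ {N} b {σ : State N} σs → σ ∈ restrict b σs → ∃[ c ] ((c ∷ σ) ∈ σs)
  ∈-restrict⁻ b ((c ∷ τ) ∷ σs) σ∈ with fits b c | σ∈
  ... | true  | here refl = c , here refl
  ... | true  | there p   = Product.map₂ there (∈-restrict⁻ b σs p)
  ... | false | p         = Product.map₂ there (∈-restrict⁻ b σs p)

  -- Conditioning on the first element: 2 is the weight of including it and `2 * L` that of leaving
  -- it out. The cells `chosen`, `rejected` and `idle` split accordingly, whereas the reduced weight
  -- of `pending` would not.
  weight-restrict : ∀ {N} (σs : List (State (suc N))) → (∀ {σ} → σ ∈ σs → NoPending σ) →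
    total weight σs ≡ 2 * total weight (restrict true σs) + 2 * L * total weight (restrict false σs)
  weight-restrict []             np = sym (*-zeroʳ (2 * L))
  weight-restrict ((pending  ∷ σ) ∷ σs) np = contradiction refl (np (here refl) zero)
  weight-restrict ((chosen   ∷ σ) ∷ σs) np rewrite weight-restrict σs (np ∘ there) =
    lemma (weight σ) _ _
    where
    lemma : ∀ w a b → 2 * w + (2 * a + b) ≡ 2 * (w + a) + b
    lemma = solve-∀
  weight-restrict ((rejected ∷ σ) ∷ σs) np rewrite weight-restrict σs (np ∘ there) =
    lemma (2 * L) (weight σ) (total weight (restrict true σs)) (total weight (restrict false σs))
    where
    lemma : ∀ l w a b → l * w + (2 * a + l * b) ≡ 2 * a + l * (w + b)
    lemma = solve-∀
  weight-restrict ((idle     ∷ σ) ∷ σs) np rewrite weight-restrict σs (np ∘ there) =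
    lemma (2 * L) (weight σ) (total weight (restrict true σs)) (total weight (restrict false σs))
    where
    lemma : ∀ l w a b → (2 + l) * w + (2 * a + l * b) ≡ 2 * (w + a) + l * (w + b)
    lemma = solve-∀

  -- The method of conditional expectations: the elements are fixed one by one, each time on a side
  -- where the total weight stays below the full weight. At the end a total below 1 leaves no event.
  first-moment : ∀ {N} (σs : List (State N)) → (∀ {σ} → σ ∈ σs → NoPending σ) →
    total weight σs < (2 + 2 * L) ^ N → ∃[ G ] (∀ {σ} → σ ∈ σs → ¬ Compatible G σ)
  first-moment {zero}  []        np lt = [] , λ ()
  first-moment {zero}  ([] ∷ σs) np (s≤s ())
  first-moment {suc N} σs        np lt with total weight (restrict true σs) <? (2 + 2 * L) ^ N
  ... | yes lt₁ with first-moment (restrict true σs) (λ p i → np (proj₂ (∈-restrict⁻ true σs p)) (suc i)) lt₁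
  ...   | G , bad = true ∷ G , λ { {c ∷ σ} σ∈ fit → bad (∈-restrict true σs σ∈ (fit zero)) (fit ∘ suc) }
  first-moment {suc N} σs np lt | no ≮₁ with total weight (restrict false σs) <? (2 + 2 * L) ^ N
  ... | yes lt₂ with first-moment (restrict false σs) (λ p i → np (proj₂ (∈-restrict⁻ false σs p)) (suc i)) lt₂
  ...   | G , bad = false ∷ G , λ { {c ∷ σ} σ∈ fit → bad (∈-restrict false σs σ∈ (fit zero)) (fit ∘ suc) }
  first-moment {suc N} σs np lt | no ≮₁ | no ≮₂ = contradiction lt (≤⇒≯ (begin
    (2 + 2 * L) * (2 + 2 * L) ^ N
      ≡⟨ *-distribʳ-+ ((2 + 2 * L) ^ N) 2 (2 * L) ⟩
    2 * (2 + 2 * L) ^ N + 2 * L * (2 + 2 * L) ^ N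
      ≤⟨ +-mono-≤ (*-monoʳ-≤ 2 (≮⇒≥ ≮₁)) (*-monoʳ-≤ (2 * L) (≮⇒≥ ≮₂)) ⟩
    2 * total weight (restrict true σs) + 2 * L * total weight (restrict false σs)
      ≡⟨ weight-restrict σs np ⟨
    total weight σs ∎))

  is-open : Cell → Bool
  is-open chosen   = false
  is-open rejected = false
  is-open pending  = true
  is-open idle     = true

  open-heavy : ∀ c → is-open c ≡ true → L * cell-weight chosen ≤ cell-weight c
  open-heavy pending _ = ≤-trans (≤-reflexive (*-comm L 2)) (m≤n+m (2 * L) 1)
  open-heavy idle    _ = ≤-trans (≤-reflexive (*-comm L 2)) (m≤n+m (2 * L) 2)

  cell-weight>0 : ∀ c → is-open c ≡ true → NonZero (cell-weight c)
  cell-weight>0 pending _ = _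
  cell-weight>0 idle    _ = _

  -- Choosing an open element lowers its cell weight from at least `2 * L` to 2, hence one factor
  -- `L` for each element.
  weight-choose : ∀ {N} (σ : State N) xs → Unique xs → All (λ x → is-open (lookup σ x) ≡ true) xs →
    L ^ length xs * weight (mark chosen xs σ) ≤ weight σ
  weight-choose σ []       _          _          = ≤-reflexive (*-identityˡ _)
  weight-choose σ (x ∷ xs) u@(_ ∷ uxs) (ox ∷ oxs) =
    *-cancelˡ-≤ (cell-weight (lookup σ x)) {{cell-weight>0 _ ox}} (begin
      w * (L * ℓ * weight (τ [ x ]≔ chosen))   ≡⟨ lemma₁ w L ℓ _ ⟩
      L * ℓ * (w * weight (τ [ x ]≔ chosen))   ≡⟨ cong (λ c → L * ℓ * (cell-weight c * weight (τ [ x ]≔ chosen))) unmarked ⟨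
      L * ℓ * (cell-weight (lookup τ x) * weight (τ [ x ]≔ chosen))
        ≡⟨ cong (L * ℓ *_) (weight-update τ x chosen) ⟩
      L * ℓ * (2 * weight τ)                   ≡⟨ lemma₂ L ℓ 2 (weight τ) ⟩
      L * 2 * (ℓ * weight τ)                   ≤⟨ *-mono-≤ (open-heavy _ ox) (weight-choose σ xs uxs oxs) ⟩
      w * weight σ                             ∎)
    where
    τ = mark chosen xs σ
    w = cell-weight (lookup σ x)
    ℓ = L ^ length xs
    unmarked : lookup τ x ≡ lookup σ x
    unmarked = lookup-mark-∉ chosen σ (Unique[x∷xs]⇒x∉xs u)
    lemma₁ : ∀ w a l v → w * (a * l * v) ≡ a * l * (w * v)
    lemma₁ = solve-∀
    lemma₂ : ∀ a l b v → a * l * (b * v) ≡ a * b * (l * v)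
    lemma₂ = solve-∀

  initial : ∀ {N} → List (Fin N) → State N
  initial T = mark pending T (replicate _ idle)

  lookup-initial : ∀ {N} T (i : Fin N) → (lookup (initial T) i ≡ pending × i ∈ T) ⊎ lookup (initial T) i ≡ idle
  lookup-initial T i with DecMembership._∈?_ Finₚ._≟_ i T
  ... | yes i∈ = inj₁ (lookup-mark-∈ pending _ i∈ , i∈)
  ... | no  i∉ = inj₂ (trans (lookup-mark-∉ pending _ i∉) (lookup-replicate i idle))

  -- Without division: every pending element contributes a factor `(2L + 1)/(2L + 2)` to the
  -- probability. These factors beat the number of sets `T`.
  weight-initial : ∀ {N} (T : List (Fin N)) → Unique T →
    (2 + 2 * L) ^ length T * weight (initial T) ≡ (1 + 2 * L) ^ length T * (2 + 2 * L) ^ N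
  weight-initial {N} []        _           = cong (_+ 0) (weight-idle N)
  weight-initial {N} (x ∷ xs) u@(_ ∷ uxs) = begin-equality
    s * s ^ k * weight (initial xs [ x ]≔ pending)     ≡⟨ lemma₁ s (s ^ k) _ ⟩
    s ^ k * (s * weight (initial xs [ x ]≔ pending))
      ≡⟨ cong (λ c → s ^ k * (cell-weight c * weight (initial xs [ x ]≔ pending))) unmarked ⟨
    s ^ k * (cell-weight (lookup (initial xs) x) * weight (initial xs [ x ]≔ pending))
      ≡⟨ cong (s ^ k *_) (weight-update (initial xs) x pending) ⟩
    s ^ k * (c * weight (initial xs))                  ≡⟨ lemma₂ c (s ^ k) _ ⟩
    c * (s ^ k * weight (initial xs))                  ≡⟨ cong (c *_) (weight-initial xs uxs) ⟩
    c * (c ^ k * s ^ N)                              ≡⟨ *-assoc c (c ^ k) (s ^ N) ⟨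
    c * c ^ k * s ^ N                                ∎
    where
    s = 2 + 2 * L
    c = 1 + 2 * L
    k = length xs
    unmarked : lookup (initial xs) x ≡ idle
    unmarked = trans (lookup-mark-∉ pending _ (Unique[x∷xs]⇒x∉xs u)) (lookup-replicate x idle)
    lemma₁ : ∀ s t w → s * t * w ≡ t * (s * w)
    lemma₁ = solve-∀
    lemma₂ : ∀ c t w → t * (c * w) ≡ c * (t * w)
    lemma₂ = solve-∀

-- The hypothesis `light` says that the sum of `L^(-|C|)` over the copies `C` at `f` is at most
-- `1/(1 + 2L)`. To avoid fractions it is stated for every `ν` with `ν C` at most `X / L^|C|`.
module Deletion (L N : ℕ) (copiesAt : Fin N → List (List (Fin N)))
  (light : ∀ f (ν : List (Fin N) → ℕ) X → (∀ C → L ^ length C * ν C ≤ X) →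
           (1 + 2 * L) * total ν (copiesAt f) ≤ X) where

  open Weighted L
  open DecMembership (Finₚ._≟_ {N}) using (_∈?_)
  open DecUnique (Finₚ._≟_ {N}) using (unique?)

  Open : State N → List (Fin N) → Set
  Open σ C = All (λ x → is-open (lookup σ x) ≡ true) C

  Usable : Fin N → State N → List (Fin N) → Set
  Usable f σ C = Unique C × f ∈ C × Open σ C

  usable? : ∀ f σ C → Dec (Usable f σ C)
  usable? f σ C = unique? C ×-dec f ∈? C ×-dec All.all? (λ x → is-open (lookup σ x) Boolₚ.≟ true) C

  use : (State N → List (State N)) → Fin N → State N → List (Fin N) → List (State N)
  use k f σ C with usable? f σ C
  ... | yes _ = k (mark chosen C σ)
  ... | no  _ = []

  expand : (State N → List (State N)) → Fin N → State N → Cell → List (State N)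
  expand k f σ pending = k (σ [ f ]≔ rejected) ++ concatMap (use k f σ) (copiesAt f)
  expand k f σ _       = k σ

  -- The cylinders covering the event that every element of T is outside the random
  -- set or in the union of disjoint copies contained in the random set.
  cylinders : List (Fin N) → State N → List (State N)
  cylinders []      σ = σ ∷ []
  cylinders (f ∷ T) σ = expand (cylinders T) f σ (lookup σ f)

  -- Of the weight `1 + 2 * L` of a pending `f`, rejection uses `2 * L`; by `weight-choose` and
  -- `light` all copies through `f` together use at most the remaining 1.
  weight-cylinders : ∀ T σ → total weight (cylinders T σ) ≤ weight σ
  weight-cylinders []      σ = ≤-reflexive (+-identityʳ _)
  weight-cylinders (f ∷ T) σ with lookup σ f in eq
  ... | chosen   = weight-cylinders T σ
  ... | rejected = weight-cylinders T σ
  ... | idle     = weight-cylinders T σ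
  ... | pending  = *-cancelˡ-≤ (1 + 2 * L) (begin
    (1 + 2 * L) * total weight (cylinders T σ′ ++ concatMap (use k f σ) (copiesAt f))
      ≡⟨ cong ((1 + 2 * L) *_) (trans (total-++ weight (cylinders T σ′) _)
           (cong (total weight (cylinders T σ′) +_) (total-concatMap weight (use k f σ) (copiesAt f)))) ⟩
    (1 + 2 * L) * (total weight (cylinders T σ′) + total (total weight ∘ use k f σ) (copiesAt f))
      ≡⟨ *-distribˡ-+ (1 + 2 * L) (total weight (cylinders T σ′)) _ ⟩
    (1 + 2 * L) * total weight (cylinders T σ′) + (1 + 2 * L) * total (total weight ∘ use k f σ) (copiesAt f)
      ≤⟨ +-mono-≤ (*-monoʳ-≤ (1 + 2 * L) (weight-cylinders T σ′)) (light f _ (weight σ) used) ⟩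
    (1 + 2 * L) * weight σ′ + weight σ
      ≡⟨ cong (λ c → cell-weight c * weight σ′ + weight σ) eq ⟨
    cell-weight (lookup σ f) * weight σ′ + weight σ
      ≡⟨ cong (_+ weight σ) (weight-update σ f rejected) ⟩
    2 * L * weight σ + weight σ
      ≡⟨ +-comm (2 * L * weight σ) (weight σ) ⟩
    (1 + 2 * L) * weight σ ∎)
    where
    k = cylinders T
    σ′ = σ [ f ]≔ rejected
    used : ∀ C → L ^ length C * total weight (use k f σ C) ≤ weight σ
    used C with usable? f σ C
    ... | no _            = ≤-trans (≤-reflexive (*-zeroʳ (L ^ length C))) z≤n
    ... | yes (u , _ , o) = ≤-trans (*-monoʳ-≤ (L ^ length C) (weight-cylinders T (mark chosen C σ)))
                                    (weight-choose σ C u o)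

  private
    ∈-tail : ∀ {f T} (σ : State N) {c} → lookup σ f ≡ c → c ≢ pending →
             ∀ i → lookup σ i ≡ pending → i ∈ f ∷ T → i ∈ T
    ∈-tail σ eq c≢ i p (here refl) = contradiction (trans (sym eq) p) c≢
    ∈-tail σ eq c≢ i p (there i∈)  = i∈

  nothing-pending : ∀ T σ → (∀ i → lookup σ i ≡ pending → i ∈ T) → ∀ {τ} → τ ∈ cylinders T σ → NoPending τ
  nothing-pending []      σ pend (here refl) i eq with pend i eq
  ... | ()
  nothing-pending (f ∷ T) σ pend {τ} τ∈ with lookup σ f in eq
  ... | chosen   = nothing-pending T σ (λ i p → ∈-tail σ eq (λ ()) i p (pend i p)) τ∈
  ... | rejected = nothing-pending T σ (λ i p → ∈-tail σ eq (λ ()) i p (pend i p)) τ∈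
  ... | idle     = nothing-pending T σ (λ i p → ∈-tail σ eq (λ ()) i p (pend i p)) τ∈
  ... | pending with ∈-++⁻ (cylinders T (σ [ f ]≔ rejected)) τ∈
  ...   | inj₁ τ∈₁ = nothing-pending T (σ [ f ]≔ rejected) pend′ τ∈₁
    where
    pend′ : ∀ i → lookup (σ [ f ]≔ rejected) i ≡ pending → i ∈ T
    pend′ i p with i Finₚ.≟ f
    ... | yes refl = contradiction (trans (sym (lookup∘update f σ rejected)) p) λ ()
    ... | no i≢f with pend i (trans (sym (lookup∘update′ i≢f σ rejected)) p)
    ...   | here i≡f = contradiction i≡f i≢f
    ...   | there i∈ = i∈
  ...   | inj₂ τ∈₂ with find (∈-concatMap⁻ (use (cylinders T) f σ) {xs = copiesAt f} τ∈₂)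
  ...     | C , _ , τ∈C with usable? f σ C
  ...       | yes (_ , f∈C , _) = nothing-pending T (mark chosen C σ) pend′ τ∈C
    where
    pend′ : ∀ i → lookup (mark chosen C σ) i ≡ pending → i ∈ T
    pend′ i p with i ∈? C
    ... | yes i∈C = contradiction (trans (sym (lookup-mark-∈ chosen σ i∈C)) p) λ ()
    ... | no  i∉C with pend i (trans (sym (lookup-mark-∉ chosen σ i∉C)) p)
    ...   | here refl = contradiction f∈C i∉C
    ...   | there i∈  = i∈

  module _ (G : Vec Bool N) where

    Inside : List (Fin N) → Set
    Inside C = ∀ {x} → x ∈ C → lookup G x ≡ true

    record Family (copies : List (List (Fin N))) : Set where
      field
        members  : List (List (Fin N))
        copy     : ∀ {C} → C ∈ members → C ∈ copies
        contained   : ∀ {C} → C ∈ members → Inside C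
        disjoint : ∀ {C D} → C ∈ members → D ∈ members → C ≡ D ⊎ (∀ {x} → x ∈ C → x ∉ D)
        maximal  : ∀ {C} → C ∈ copies → Inside C → C ≢ [] → ∃[ x ] (x ∈ C × x ∈ concat members)

    greedy : ∀ copies → Family copies
    greedy []       = record { members = [] ; copy = λ () ; contained = λ () ; disjoint = λ () ; maximal = λ () }
    greedy (C ∷ Cs) with greedy Cs
    ... | 𝓕 with All.all? (λ x → lookup G x Boolₚ.≟ true) C | any? (_∈? concat (Family.members 𝓕)) C
    ...   | no ¬in | _ = record
      { members = members ; copy = there ∘ copy ; contained = contained ; disjoint = disjoint
      ; maximal = λ { (here refl) ins _ → contradiction (All.tabulate ins) ¬in ; (there C∈) → maximal C∈ } }
      where open Family 𝓕
    ...   | yes _ | yes meets = record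
      { members = members ; copy = there ∘ copy ; contained = contained ; disjoint = disjoint
      ; maximal = λ { (here refl) _ _ → find meets ; (there C∈) → maximal C∈ } }
      where open Family 𝓕
    ...   | yes ins | no apart = record
      { members  = C ∷ members
      ; copy     = λ { (here refl) → here refl ; (there D∈) → there (copy D∈) }
      ; contained   = λ { (here refl) → All.lookup ins ; (there D∈) → contained D∈ }
      ; disjoint = λ
        { (here refl) (here refl) → inj₁ refl
        ; (here refl) (there D∈)  → inj₂ (λ x∈C x∈D → apart (lose x∈C (∈-concat⁺′ x∈D D∈)))
        ; (there D∈)  (here refl) → inj₂ (λ x∈D x∈C → apart (lose x∈C (∈-concat⁺′ x∈D D∈)))
        ; (there D∈)  (there E∈)  → disjoint D∈ E∈ }
      ; maximal  = λ
        { (here refl) _ C≢[] → nonempty C C≢[] (λ x → ∈-++⁺ˡ x)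
        ; (there D∈) ins′ D≢[] → Product.map₂ (Product.map₂ (∈-++⁺ʳ C)) (maximal D∈ ins′ D≢[]) } }
      where
      open Family 𝓕
      nonempty : ∀ D → D ≢ [] → (∀ {x} → x ∈ D → x ∈ C ++ concat members) →
                 ∃[ x ] (x ∈ D × x ∈ C ++ concat members)
      nonempty []      ne _ = contradiction refl ne
      nonempty (x ∷ _) _  f = x , here refl , f (here refl)

    module _ {copies : List (List (Fin N))}
             (copies-unique : ∀ {C} → C ∈ copies → Unique C)
             (copies-at : ∀ {C f} → C ∈ copies → f ∈ C → C ∈ copiesAt f)
             (𝓕 : Family copies) where

      open Family 𝓕

      -- The invariant of the walk through `T`: members of the family are pairwise disjoint and get
      -- chosen as a whole, so none is ever partly chosen.
      Settled : State N → List (Fin N) → Set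
      Settled σ D = (∀ {x} → x ∈ D → lookup σ x ≡ chosen) ⊎ (∀ {x} → x ∈ D → lookup σ x ≢ chosen)

      -- `G` itself directs the expansion: a pending `f` outside `G` is rejected, and for one inside
      -- `G` the member of the family that covers it is chosen.
      compatible-cylinder : ∀ T σ → Compatible G σ → (∀ {D} → D ∈ members → Settled σ D) →
        (∀ {f} → f ∈ T → lookup G f ≡ true → f ∈ concat members) →
        ∃[ τ ] (τ ∈ cylinders T σ × Compatible G τ)
      compatible-cylinder []      σ com settled cov = σ , here refl , com
      compatible-cylinder (f ∷ T) σ com settled cov with lookup σ f in eq
      ... | chosen   = compatible-cylinder T σ com settled (cov ∘ there)
      ... | rejected = compatible-cylinder T σ com settled (cov ∘ there)
      ... | idle     = compatible-cylinder T σ com settled (cov ∘ there)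
      ... | pending with lookup G f in eqG
      ...   | false with compatible-cylinder T (σ [ f ]≔ rejected) com′ settled′ (cov ∘ there)
        where
        com′ : Compatible G (σ [ f ]≔ rejected)
        com′ i with i Finₚ.≟ f
        ... | yes refl rewrite lookup∘update f σ rejected | eqG = refl
        ... | no i≢f rewrite lookup∘update′ i≢f σ rejected = com i
        settled′ : ∀ {D} → D ∈ members → Settled (σ [ f ]≔ rejected) D
        settled′ {D} D∈ with settled D∈
        ... | inj₁ all = inj₁ go
          where
          go : ∀ {x} → x ∈ D → lookup (σ [ f ]≔ rejected) x ≡ chosen
          go {x} x∈ with x Finₚ.≟ f
          ... | yes refl = contradiction (trans (sym eq) (all x∈)) λ ()
          ... | no x≢f   = trans (lookup∘update′ x≢f σ rejected) (all x∈)
        ... | inj₂ none = inj₂ go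
          where
          go : ∀ {x} → x ∈ D → lookup (σ [ f ]≔ rejected) x ≢ chosen
          go {x} x∈ p with x Finₚ.≟ f
          ... | yes refl = contradiction (trans (sym (lookup∘update f σ rejected)) p) λ ()
          ... | no x≢f   = none x∈ (trans (sym (lookup∘update′ x≢f σ rejected)) p)
      ...     | τ , τ∈ , fit = τ , ∈-++⁺ˡ τ∈ , fit
      compatible-cylinder (f ∷ T) σ com settled cov | pending | true
        with ∈-concat⁻′ members (cov (here refl) eqG)
      ... | D , f∈D , D∈ with settled D∈
      ...   | inj₁ all = contradiction (trans (sym eq) (all f∈D)) λ ()
      ...   | inj₂ none with compatible-cylinder T (mark chosen D σ) com′ settled′ (cov ∘ there)
        where
        com′ : Compatible G (mark chosen D σ)
        com′ i with i ∈? D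
        ... | yes i∈D rewrite lookup-mark-∈ chosen σ i∈D = contained D∈ i∈D
        ... | no  i∉D rewrite lookup-mark-∉ chosen σ i∉D = com i
        settled′ : ∀ {E} → E ∈ members → Settled (mark chosen D σ) E
        settled′ {E} E∈ with disjoint E∈ D∈
        ... | inj₁ refl = inj₁ (lookup-mark-∈ chosen σ)
        ... | inj₂ apart with settled E∈
        ...   | inj₁ allE  = inj₁ (λ x∈ → trans (lookup-mark-∉ chosen σ (apart x∈)) (allE x∈))
        ...   | inj₂ noneE = inj₂ (λ x∈ p → noneE x∈ (trans (sym (lookup-mark-∉ chosen σ (apart x∈))) p))
      ...     | τ , τ∈ , fit = τ ,
        ∈-++⁺ʳ (cylinders T (σ [ f ]≔ rejected))
          (∈-concatMap⁺ (use (cylinders T) f σ) {xs = copiesAt f} (lose (copies-at (copy D∈) f∈D) used)) , fit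
        where
        open-D : Open σ D
        open-D = All.tabulate go
          where
          go : ∀ {x} → x ∈ D → is-open (lookup σ x) ≡ true
          go {x} x∈ with lookup σ x in eqx | com x
          ... | chosen   | _ = contradiction eqx (none x∈)
          ... | pending  | _ = refl
          ... | idle     | _ = refl
          -- A rejected element is outside `G` while `D` lies inside, so the compatibility proof is
          -- the absurd `false ≡ true`, which is also the goal.
          ... | rejected | c rewrite contained D∈ x∈ = c
        used : τ ∈ use (cylinders T) f σ D
        used with usable? f σ D
        ... | yes _ = τ∈
        ... | no ¬u = contradiction (copies-unique (copy D∈) , f∈D , open-D) ¬u

  -- `H` is `G` minus the union of a maximal disjoint family of copies inside `G`. A nonempty copy
  -- inside `H` would contradict maximality. If `T` missed `H`, the family would cover `T` within
  -- `G`, and `G` would lie in one of the cylinders that `first-moment` avoids.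
  deletion : ∀ (copies : List (List (Fin N))) →
    (∀ {C} → C ∈ copies → Unique C) → (∀ {C f} → C ∈ copies → f ∈ C → C ∈ copiesAt f) →
    ∀ (Ts : List (List (Fin N))) τ → (∀ {T} → T ∈ Ts → Unique T × length T ≡ τ) →
    length Ts * (1 + 2 * L) ^ τ < (2 + 2 * L) ^ τ →
    ∃[ H ] ((∀ {C} → C ∈ copies → C ≢ [] → (∀ {x} → x ∈ C → H x ≡ true) → ⊥) ×
            (∀ {T} → T ∈ Ts → ∃[ x ] (x ∈ T × H x ≡ true)))
  deletion copies copies-unique copies-at Ts τ Ts-shape small with first-moment events no-pend light-events
    where
    s = 2 + 2 * L
    c = 1 + 2 * L
    events = concatMap (λ T → cylinders T (initial T)) Ts
    no-pend : ∀ {σ} → σ ∈ events → NoPending σ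
    no-pend σ∈ with find (∈-concatMap⁻ (λ T → cylinders T (initial T)) {xs = Ts} σ∈)
    ... | T , _ , σ∈T = nothing-pending T (initial T) pend σ∈T
      where
      pend : ∀ i → lookup (initial T) i ≡ pending → i ∈ T
      pend i eq with lookup-initial T i
      ... | inj₁ (_ , i∈) = i∈
      ... | inj₂ eq′      = contradiction (trans (sym eq′) eq) λ ()
    light-events : total weight events < s ^ N
    light-events = *-cancelˡ-< (s ^ τ) _ _ (begin-strict
      s ^ τ * total weight events
        ≡⟨ cong (s ^ τ *_) (total-concatMap weight (λ T → cylinders T (initial T)) Ts) ⟩
      s ^ τ * total (λ T → total weight (cylinders T (initial T))) Ts
        ≤⟨ *-monoʳ-≤ (s ^ τ) (total-mono Ts (λ {T} _ → weight-cylinders T (initial T))) ⟩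
      s ^ τ * total (λ T → weight (initial T)) Ts
        ≡⟨ *-comm (s ^ τ) _ ⟩
      total (λ T → weight (initial T)) Ts * s ^ τ
        ≡⟨ total-*ʳ (λ T → weight (initial T)) (s ^ τ) Ts ⟨
      total (λ T → weight (initial T) * s ^ τ) Ts
        ≤⟨ total-≤ (c ^ τ * s ^ N) Ts one ⟩
      length Ts * (c ^ τ * s ^ N)
        ≡⟨ *-assoc (length Ts) (c ^ τ) (s ^ N) ⟨
      length Ts * c ^ τ * s ^ N
        <⟨ *-monoˡ-< (s ^ N) {{m^n≢0 s N}} small ⟩
      s ^ τ * s ^ N ∎)
      where
      one : ∀ {T} → T ∈ Ts → weight (initial T) * s ^ τ ≤ c ^ τ * s ^ N
      one {T} T∈ with Ts-shape T∈
      ... | u , refl = ≤-reflexive (trans (*-comm (weight (initial T)) _) (weight-initial T u))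
  ... | G , avoids = H , no-copy , hits
    where
    𝓕 = greedy G copies
    open Family 𝓕
    H : Fin N → Bool
    H x = lookup G x ∧ not (does (x ∈? concat members))
    H⇒G : ∀ x → H x ≡ true → lookup G x ≡ true
    H⇒G x eq with lookup G x
    ... | true = refl
    ... | false = eq
    H⇒∉ : ∀ x → H x ≡ true → x ∉ concat members
    H⇒∉ x eq with lookup G x | x ∈? concat members
    ... | true | no x∉ = x∉
    no-copy : ∀ {C} → C ∈ copies → C ≢ [] → (∀ {x} → x ∈ C → H x ≡ true) → ⊥
    no-copy C∈ C≢[] ins with maximal C∈ (λ x∈ → H⇒G _ (ins x∈)) C≢[]
    ... | x , x∈C , x∈ = H⇒∉ x (ins x∈C) x∈
    hits : ∀ {T} → T ∈ Ts → ∃[ x ] (x ∈ T × H x ≡ true)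
    hits {T} T∈ with ∃∈⊎∀∈ (λ x → H x Boolₚ.≟ true) T
    ... | inj₁ p = p
    ... | inj₂ none with compatible-cylinder G copies-unique copies-at 𝓕 T (initial T) com settled cov
      where
      com : Compatible G (initial T)
      com i with lookup-initial T i
      ... | inj₁ (eq , _) rewrite eq = refl
      ... | inj₂ eq       rewrite eq = refl
      settled : ∀ {D} → D ∈ members → Settled G copies-unique copies-at 𝓕 (initial T) D
      settled _ = inj₂ λ {x} _ eq → not-chosen x eq
        where
        not-chosen : ∀ x → lookup (initial T) x ≢ chosen
        not-chosen x eq with lookup-initial T x
        ... | inj₁ (eq′ , _) = contradiction (trans (sym eq′) eq) λ ()
        ... | inj₂ eq′       = contradiction (trans (sym eq′) eq) λ ()
      cov : ∀ {f} → f ∈ T → lookup G f ≡ true → f ∈ concat members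
      cov {f} f∈ Gf with f ∈? concat members in eq
      ... | yes p = p
      ... | no _  = contradiction (cong₂ (λ a b → a ∧ not b) Gf (cong does eq)) (none f∈)
    ...   | τ , τ∈ , fit =
      contradiction fit (avoids (∈-concatMap⁺ (λ T → cylinders T (initial T)) {xs = Ts} (lose T∈ τ∈)))

-- Pairs of vertices and copies of forbidden shapes

length-cartesianProductWith : ∀ {A B C : Set} (f : A → B → C) xs ys →
  length (cartesianProductWith f xs ys) ≡ length xs * length ys
length-cartesianProductWith f []       ys = refl
length-cartesianProductWith f (x ∷ xs) ys =
  trans (length-++ (map (f x) ys)) (cong₂ _+_ (length-map (f x) ys) (length-cartesianProductWith f xs ys))

module _ {A : Set} where

  sublists : ℕ → List A → List (List A)
  sublists zero    _        = [] ∷ []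
  sublists (suc k) []       = []
  sublists (suc k) (x ∷ xs) = map (x ∷_) (sublists k xs) ++ sublists (suc k) xs

  length-sublists : ∀ k xs → length (sublists k xs) ≤ 2 ^ length xs
  length-sublists zero    xs       = m^n>0 2 (length xs)
  length-sublists (suc k) []       = z≤n
  length-sublists (suc k) (x ∷ xs) = begin
    length (map (x ∷_) (sublists k xs) ++ sublists (suc k) xs)
      ≡⟨ length-++ (map (x ∷_) (sublists k xs)) ⟩
    length (map (x ∷_) (sublists k xs)) + length (sublists (suc k) xs)
      ≡⟨ cong (_+ _) (length-map (x ∷_) (sublists k xs)) ⟩
    length (sublists k xs) + length (sublists (suc k) xs)
      ≤⟨ +-mono-≤ (length-sublists k xs) (≤-trans (length-sublists (suc k) xs) (m≤m+n _ 0)) ⟩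
    2 ^ length (x ∷ xs) ∎

  ∈-sublists : ∀ k xs {C} → C ∈ sublists k xs → length C ≡ k × (∀ {x} → x ∈ C → x ∈ xs)
  ∈-sublists zero    xs       (here refl) = refl , λ ()
  ∈-sublists (suc k) (x ∷ xs) C∈ with ∈-++⁻ (map (x ∷_) (sublists k xs)) C∈
  ... | inj₂ C∈′ with ∈-sublists (suc k) xs C∈′
  ...   | len , sub = len , there ∘ sub
  ∈-sublists (suc k) (x ∷ xs) C∈ | inj₁ C∈′ with ∈-map⁻ (x ∷_) C∈′
  ... | D , D∈ , refl with ∈-sublists k xs D∈
  ...   | len , sub = cong suc len , λ { (here eq) → here eq ; (there y∈) → there (sub y∈) }

  Unique-sublists : ∀ k xs {C} → Unique xs → C ∈ sublists k xs → Unique C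
  Unique-sublists zero    xs       _ (here refl) = []
  Unique-sublists (suc k) (x ∷ xs) (x∉ ∷ u) C∈ with ∈-++⁻ (map (x ∷_) (sublists k xs)) C∈
  ... | inj₂ C∈′ = Unique-sublists (suc k) xs u C∈′
  ... | inj₁ C∈′ with ∈-map⁻ (x ∷_) C∈′
  ...   | D , D∈ , refl =
    All.tabulate (λ p → All.lookup x∉ (proj₂ (∈-sublists k xs D∈) p)) ∷ Unique-sublists k xs u D∈

  filter∈sublists : ∀ (H : A → Bool) xs →
    let ys = filter (λ x → H x Boolₚ.≟ true) xs in ys ∈ sublists (length ys) xs
  filter∈sublists H []       = here refl
  filter∈sublists H (x ∷ xs) with H x
  ... | true  = ∈-++⁺ˡ (∈-map⁺ (x ∷_) (filter∈sublists H xs))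
  ... | false with filter (λ x → H x Boolₚ.≟ true) xs | filter∈sublists H xs
  ...   | []    | _ = here refl
  ...   | z ∷ _ | p = ∈-++⁺ʳ (map (x ∷_) _) p

module Pairs (n : ℕ) where

  -- An unordered pair is coded by the ordered pair with the smaller entry first. The other elements
  -- of `Fin (n * n)` code no pair of distinct vertices.
  key : Fin n → Fin n → Fin (n * n)
  key i j with toℕ i ≤? toℕ j
  ... | yes _ = combine i j
  ... | no  _ = combine j i

  key-combine : ∀ i j → key i j ≡ combine i j ⊎ key i j ≡ combine j i
  key-combine i j with toℕ i ≤? toℕ j
  ... | yes _ = inj₁ refl
  ... | no  _ = inj₂ refl

  key-sym : ∀ i j → key i j ≡ key j i
  key-sym i j with toℕ i ≤? toℕ j | toℕ j ≤? toℕ i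
  ... | yes p | yes q with Finₚ.toℕ-injective (≤-antisym p q)
  ...   | refl = refl
  key-sym i j | yes _ | no _  = refl
  key-sym i j | no _  | yes _ = refl
  key-sym i j | no p  | no q  = contradiction (<⇒≤ (≰⇒> q)) p

  combine-key : ∀ a b i j → combine a b ≡ key i j → (a ≡ i × b ≡ j) ⊎ (a ≡ j × b ≡ i)
  combine-key a b i j eq with key-combine i j
  ... | inj₁ p = inj₁ (Finₚ.combine-injective a b i j (trans eq p))
  ... | inj₂ p = inj₂ (Finₚ.combine-injective a b j i (trans eq p))

  key-injective : ∀ a b i j → key a b ≡ key i j → (a ≡ i × b ≡ j) ⊎ (a ≡ j × b ≡ i)
  key-injective a b i j eq with key-combine a b
  ... | inj₁ p = combine-key a b i j (trans (sym p) eq)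
  ... | inj₂ p with combine-key b a i j (trans (sym p) eq)
  ...   | inj₁ (q , r) = inj₂ (r , q)
  ...   | inj₂ (q , r) = inj₁ (r , q)

  pairs : List (Fin n) → List (Fin (n * n))
  pairs []       = []
  pairs (x ∷ xs) = map (key x) xs ++ pairs xs

  length-pairs : ∀ xs → length (pairs xs) ≡ tri (length xs)
  length-pairs []       = refl
  length-pairs (x ∷ xs) = trans (length-++ (map (key x) xs)) (cong₂ _+_ (length-map (key x) xs) (length-pairs xs))

  ∈-pairs⁻ : ∀ xs {f} → Unique xs → f ∈ pairs xs → ∃[ x ] ∃[ y ] (x ∈ xs × y ∈ xs × x ≢ y × f ≡ key x y)
  ∈-pairs⁻ (x ∷ xs) u@(_ ∷ uxs) f∈ with ∈-++⁻ (map (key x) xs) f∈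
  ... | inj₁ p with ∈-map⁻ (key x) p
  ...   | y , y∈ , eq = x , y , here refl , there y∈ , (λ { refl → Unique[x∷xs]⇒x∉xs u y∈ }) , eq
  ∈-pairs⁻ (x ∷ xs) (_ ∷ uxs) f∈ | inj₂ p with ∈-pairs⁻ xs uxs p
  ...   | y , z , y∈ , z∈ , rest = y , z , there y∈ , there z∈ , rest

  Unique-pairs : ∀ xs → Unique xs → Unique (pairs xs)
  Unique-pairs []       _           = []
  Unique-pairs (x ∷ xs) u@(_ ∷ uxs) = Uniqueₚ.++⁺ (Uniqueₚ.map⁺ key-x-injective uxs) (Unique-pairs xs uxs) disjoint
    where
    key-x-injective : ∀ {y z} → key x y ≡ key x z → y ≡ z
    key-x-injective {y} {z} eq with key-injective x y x z eq
    ... | inj₁ (_ , q) = q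
    ... | inj₂ (p , q) = trans q p
    x∉ : x ∉ xs
    x∉ = Unique[x∷xs]⇒x∉xs u
    disjoint : ∀ {f} → f ∈ map (key x) xs × f ∈ pairs xs → ⊥
    disjoint (p , q) with ∈-map⁻ (key x) p | ∈-pairs⁻ xs uxs q
    ... | w , _ , eq | y , z , y∈ , z∈ , _ , eq′ with key-injective x w y z (trans (sym eq) eq′)
    ...   | inj₁ (refl , _) = x∉ y∈
    ...   | inj₂ (refl , _) = x∉ z∈

  prepend : List (List (Fin n)) → List (List (Fin n))
  prepend = cartesianProductWith _∷_ (allFin n)

  length-prepend : ∀ xss → length (prepend xss) ≡ n * length xss
  length-prepend xss = trans (length-cartesianProductWith _∷_ (allFin n) xss)
                             (cong (_* length xss) (length-tabulate {n = n} id))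

  ∈-prepend : ∀ {x xs xss} → xs ∈ xss → x ∷ xs ∈ prepend xss
  ∈-prepend {x} = ∈-cartesianProductWith⁺ _∷_ (∈-allFin x)

  tuples : ℕ → List (List (Fin n))
  tuples zero    = [] ∷ []
  tuples (suc v) = prepend (tuples v)

  length-tuples : ∀ v → length (tuples v) ≡ n ^ v
  length-tuples zero    = refl
  length-tuples (suc v) = trans (length-prepend (tuples v)) (cong (n *_) (length-tuples v))

  ∈-tuples : ∀ xs → xs ∈ tuples (length xs)
  ∈-tuples []       = here refl
  ∈-tuples (x ∷ xs) = ∈-prepend (∈-tuples xs)

  ∈-tuples⁻ : ∀ v {xs} → xs ∈ tuples v → length xs ≡ v
  ∈-tuples⁻ zero    (here refl) = refl
  ∈-tuples⁻ (suc v) xs∈ with ∈-cartesianProductWith⁻ _∷_ (allFin n) (tuples v) xs∈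
  ... | x , ys , _ , ys∈ , refl = cong suc (∈-tuples⁻ v ys∈)

  containing : Fin n → ℕ → List (List (Fin n))
  containing y zero    = []
  containing y (suc v) = map (y ∷_) (tuples v) ++ prepend (containing y v)

  ∈-containing : ∀ {y} xs → y ∈ xs → xs ∈ containing y (length xs)
  ∈-containing (x ∷ xs) (here refl) = ∈-++⁺ˡ (∈-map⁺ (x ∷_) (∈-tuples xs))
  ∈-containing (x ∷ xs) (there y∈)  = ∈-++⁺ʳ (map _ (tuples (length xs))) (∈-prepend (∈-containing xs y∈))

  length-containing : ∀ y v → length (containing y (suc v)) ≡ suc v * n ^ v
  length-containing y zero    = cong suc (trans (length-prepend []) (*-zeroʳ n))
  length-containing y (suc v) = trans (length-++ (map (y ∷_) (tuples (suc v)))) (trans (cong₂ _+_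
    (trans (length-map (y ∷_) (tuples (suc v))) (length-tuples (suc v)))
    (trans (length-prepend (containing y (suc v))) (cong (n *_) (length-containing y v))))
    (lemma n (suc v) (n ^ v)))
    where
    lemma : ∀ n v p → n * p + n * (v * p) ≡ suc v * (n * p)
    lemma = solve-∀

  -- Each tuple is listed once for every two distinct positions holding `i` and `j`, which explains
  -- the length `v (v - 1) n^(v-2)`.
  through : Fin n → Fin n → ℕ → List (List (Fin n))
  through i j zero    = []
  through i j (suc v) = map (i ∷_) (containing j v) ++ map (j ∷_) (containing i v) ++ prepend (through i j v)

  ∈-through : ∀ i j xs → combine i j ∈ pairs xs → xs ∈ through i j (length xs)
  ∈-through i j (x ∷ xs) f∈ with ∈-++⁻ (map (key x) xs) f∈
  ... | inj₂ p = ∈-++⁺ʳ (map (i ∷_) (containing j (length xs)))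
                   (∈-++⁺ʳ (map (j ∷_) (containing i (length xs))) (∈-prepend (∈-through i j xs p)))
  ... | inj₁ p with ∈-map⁻ (key x) p
  ...   | y , y∈ , eq with combine-key i j x y eq
  ...     | inj₁ (refl , refl) = ∈-++⁺ˡ (∈-map⁺ (x ∷_) (∈-containing xs y∈))
  ...     | inj₂ (refl , refl) = ∈-++⁺ʳ (map (i ∷_) (containing j (length xs)))
                                   (∈-++⁺ˡ (∈-map⁺ (x ∷_) (∈-containing xs y∈)))

  length-through-step : ∀ i j v → length (through i j (suc v)) ≡
    length (containing j v) + (length (containing i v) + n * length (through i j v))
  length-through-step i j v = trans (length-++ (map (i ∷_) (containing j v))) (cong₂ _+_
    (length-map (i ∷_) (containing j v))
    (trans (length-++ (map (j ∷_) (containing i v))) (cong₂ _+_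
      (length-map (j ∷_) (containing i v)) (length-prepend (through i j v)))))

  length-through₂ : ∀ i j w → length (through i j (2 + w)) ≡ (2 + w) * (1 + w) * n ^ w
  length-through₂ i j w rewrite length-through-step i j (suc w) | length-containing j w | length-containing i w
    with w
  ... | zero rewrite length-through-step i j 0 | *-zeroʳ n | *-zeroʳ n = refl
  ... | suc w′ rewrite length-through₂ i j w′ = lemma n w′ (n ^ w′)
    where
    lemma : ∀ n w p → (2 + w) * (n * p) + ((2 + w) * (n * p) + n * ((2 + w) * (1 + w) * p)) ≡
                      (3 + w) * (2 + w) * (n * p)
    lemma = solve-∀

  length-through : ∀ i j v → length (through i j v) ≤ v * v * n ^ (v ∸ 2)
  length-through i j zero          = z≤n
  length-through i j (suc zero)    = ≤-trans (≤-reflexive (trans (length-through-step i j 0) (*-zeroʳ n))) z≤n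
  length-through i j (suc (suc w)) = ≤-trans (≤-reflexive (length-through₂ i j w))
    (*-monoˡ-≤ (n ^ w) (*-monoʳ-≤ (2 + w) (n≤1+n (1 + w))))

  -- The shape (v , e) stands for all graphs with v vertices and e edges.
  module Avoid (shapes : List (ℕ × ℕ)) (L : ℕ) .{{_ : NonZero L}}
    (rare : ∀ {v e} → (v , e) ∈ shapes →
      (1 + 2 * L) * (length shapes * (v * v * n ^ (v ∸ 2) * 2 ^ tri v)) ≤ L ^ e) where

    unique? = DecUnique.unique? (Finₚ._≟_ {n})

    copies : List (List (Fin (n * n)))
    copies = concatMap (λ (v , e) → concatMap (sublists e ∘ pairs) (filter unique? (tuples v))) shapes

    -- The filter by length makes `length xs ≡ v` available to the estimate in `light`.
    copiesAt : Fin (n * n) → List (List (Fin (n * n)))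
    copiesAt f = let i , j = remQuot {n} n f in
      concatMap (λ (v , e) → concatMap (sublists e ∘ pairs) (filter (λ xs → length xs ≟ v) (through i j v))) shapes

    ∈-copies⁻ : ∀ {C} → C ∈ copies →
      ∃[ v ] ∃[ e ] ∃[ xs ] ((v , e) ∈ shapes × Unique xs × length xs ≡ v × C ∈ sublists e (pairs xs))
    ∈-copies⁻ C∈ with find (∈-concatMap⁻ _ {xs = shapes} C∈)
    ... | (v , e) , s∈ , C∈′ with find (∈-concatMap⁻ (sublists e ∘ pairs) {xs = filter unique? (tuples v)} C∈′)
    ...   | xs , xs∈ , C∈″ with ∈-filter⁻ unique? {xs = tuples v} xs∈
    ...     | xs∈t , u = v , e , xs , s∈ , u , ∈-tuples⁻ v xs∈t , C∈″

    ∈-copies⁺ : ∀ {e xs C} → (length xs , e) ∈ shapes → Unique xs → C ∈ sublists e (pairs xs) → C ∈ copies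
    ∈-copies⁺ {e} {xs} s∈ u C∈ = ∈-concatMap⁺ _ (lose s∈
      (∈-concatMap⁺ (sublists e ∘ pairs) (lose (∈-filter⁺ unique? (∈-tuples xs) u) C∈)))

    copies-unique : ∀ {C} → C ∈ copies → Unique C
    copies-unique C∈ with ∈-copies⁻ C∈
    ... | v , e , xs , _ , u , _ , C∈′ = Unique-sublists e (pairs xs) (Unique-pairs xs u) C∈′

    copies-at : ∀ {C f} → C ∈ copies → f ∈ C → C ∈ copiesAt f
    copies-at {C} {f} C∈ f∈ with ∈-copies⁻ C∈
    ... | v , e , xs , s∈ , u , refl , C∈′ = ∈-concatMap⁺ _ (lose s∈ (∈-concatMap⁺ (sublists e ∘ pairs)
      (lose (∈-filter⁺ (λ ys → length ys ≟ v) (∈-through _ _ xs f∈pairs) refl) C∈′)))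
      where
      f∈pairs : combine (proj₁ (remQuot {n} n f)) (proj₂ (remQuot {n} n f)) ∈ pairs xs
      f∈pairs = subst (_∈ pairs xs) (sym (Finₚ.combine-remQuot {n} n f)) (proj₂ (∈-sublists e (pairs xs) C∈′) f∈)

    -- Every shape receives the share `1/K` of the bound. A pair lies in at most `v² n^(v-2)`
    -- tuples, each tuple carries at most `2^(tri v)` edge sets of size `e`, and each of these
    -- counts at most `X / L^e`; `rare` is the resulting inequality.
    light : ∀ f (ν : List (Fin (n * n)) → ℕ) X → (∀ C → L ^ length C * ν C ≤ X) →
            (1 + 2 * L) * total ν (copiesAt f) ≤ X
    light f ν X νX = conclude shapes refl
      where
      c = 1 + 2 * L
      K = length shapes
      i = proj₁ (remQuot {n} n f)
      j = proj₂ (remQuot {n} n f)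
      at : ℕ × ℕ → List (List (Fin (n * n)))
      at (v , e) = concatMap (sublists e ∘ pairs) (filter (λ xs → length xs ≟ v) (through i j v))

      one-tuple : ∀ v e xs → length xs ≡ v → L ^ e * total ν (sublists e (pairs xs)) ≤ 2 ^ tri v * X
      one-tuple v e xs len = begin
        L ^ e * total ν ys                       ≡⟨ *-comm (L ^ e) _ ⟩
        total ν ys * L ^ e                       ≡⟨ total-*ʳ ν (L ^ e) ys ⟨
        total (λ C → ν C * L ^ e) ys             ≤⟨ total-≤ X ys bound ⟩
        length ys * X                            ≤⟨ *-monoˡ-≤ X (length-sublists e (pairs xs)) ⟩
        2 ^ length (pairs xs) * X                ≡⟨ cong (λ k → 2 ^ k * X) (trans (length-pairs xs) (cong tri len)) ⟩
        2 ^ tri v * X                            ∎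
        where
        ys = sublists e (pairs xs)
        bound : ∀ {C} → C ∈ ys → ν C * L ^ e ≤ X
        bound {C} C∈ with ∈-sublists e (pairs xs) C∈
        ... | refl , _ = ≤-trans (≤-reflexive (*-comm (ν C) _)) (νX C)

      one-shape : ∀ {s} → s ∈ shapes → K * (c * total ν (at s)) ≤ X
      one-shape {v , e} s∈ = *-cancelˡ-≤ (L ^ e) {{m^n≢0 L e}} (begin
        L ^ e * (K * (c * total ν (at (v , e))))
          ≡⟨ lemma₁ (L ^ e) K c _ ⟩
        c * K * (L ^ e * total ν (at (v , e)))
          ≤⟨ *-monoʳ-≤ (c * K) all-tuples ⟩
        c * K * (v * v * n ^ (v ∸ 2) * (2 ^ tri v * X))
          ≡⟨ lemma₂ c K (v * v * n ^ (v ∸ 2)) (2 ^ tri v) X ⟩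
        c * (K * (v * v * n ^ (v ∸ 2) * 2 ^ tri v)) * X
          ≤⟨ *-monoˡ-≤ X (rare s∈) ⟩
        L ^ e * X ∎)
        where
        lemma₁ : ∀ l k c t → l * (k * (c * t)) ≡ c * k * (l * t)
        lemma₁ = solve-∀
        lemma₂ : ∀ c k a b x → c * k * (a * (b * x)) ≡ c * (k * (a * b)) * x
        lemma₂ = solve-∀
        xss = filter (λ xs → length xs ≟ v) (through i j v)
        all-tuples : L ^ e * total ν (at (v , e)) ≤ v * v * n ^ (v ∸ 2) * (2 ^ tri v * X)
        all-tuples = begin
          L ^ e * total ν (at (v , e))
            ≡⟨ cong (L ^ e *_) (total-concatMap ν (sublists e ∘ pairs) xss) ⟩
          L ^ e * total (total ν ∘ sublists e ∘ pairs) xss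
            ≡⟨ *-comm (L ^ e) _ ⟩
          total (total ν ∘ sublists e ∘ pairs) xss * L ^ e
            ≡⟨ total-*ʳ (total ν ∘ sublists e ∘ pairs) (L ^ e) xss ⟨
          total (λ xs → total ν (sublists e (pairs xs)) * L ^ e) xss
            ≤⟨ total-≤ (2 ^ tri v * X) xss (λ {xs} xs∈ → ≤-trans (≤-reflexive (*-comm _ (L ^ e)))
                 (one-tuple v e xs (proj₂ (∈-filter⁻ (λ ys → length ys ≟ v) {xs = through i j v} xs∈)))) ⟩
          length xss * (2 ^ tri v * X)
            ≤⟨ *-monoˡ-≤ (2 ^ tri v * X) (≤-trans (length-filter _ (through i j v)) (length-through i j v)) ⟩
          v * v * n ^ (v ∸ 2) * (2 ^ tri v * X) ∎

      -- The list is split into cases so that `K` is known to be nonzero before it is cancelled.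
      conclude : ∀ ss → shapes ≡ ss → c * total ν (copiesAt f) ≤ X
      conclude []      eq = ≤-trans (≤-reflexive (trans (cong (λ ss → c * total ν (concatMap at ss)) eq) (*-zeroʳ c))) z≤n
      conclude (_ ∷ _) eq = *-cancelˡ-≤ K {{subst (NonZero ∘ length) (sym eq) _}} (begin
        K * (c * total ν (copiesAt f))                  ≡⟨ *-assoc K c _ ⟨
        K * c * total ν (copiesAt f)                    ≡⟨ cong (K * c *_) (total-concatMap ν at shapes) ⟩
        K * c * total (total ν ∘ at) shapes             ≡⟨ *-comm (K * c) _ ⟩
        total (total ν ∘ at) shapes * (K * c)           ≡⟨ total-*ʳ (total ν ∘ at) (K * c) shapes ⟨
        total (λ s → total ν (at s) * (K * c)) shapes
          ≤⟨ total-≤ X shapes (λ {s} s∈ → ≤-trans (≤-reflexive (lemma (total ν (at s)) K c)) (one-shape s∈)) ⟩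
        K * X                                           ∎)
        where
        lemma : ∀ t k c → t * (k * c) ≡ k * (c * t)
        lemma = solve-∀

    independent-candidates : ℕ → List (List (Fin (n * n)))
    independent-candidates t = map pairs (filter unique? (tuples t))

    -- The copy considered consists of all `H`-edges inside `xs`; `0 < e` excludes the empty copy,
    -- which no deletion can destroy.
    AvoidsShapes : (Fin (n * n) → Bool) → Set
    AvoidsShapes H = ∀ xs → Unique xs → let e = length (filter (λ f → H f Boolₚ.≟ true) (pairs xs)) in
      0 < e → (length xs , e) ∉ shapes

    Meets : ℕ → (Fin (n * n) → Bool) → Set
    Meets t H = ∀ xs → Unique xs → length xs ≡ t →
      ∃[ x ] ∃[ y ] (x ∈ xs × y ∈ xs × x ≢ y × H (key x y) ≡ true)

    avoids-shapes : ∀ H → (∀ {C} → C ∈ copies → C ≢ [] → (∀ {x} → x ∈ C → H x ≡ true) → ⊥) → AvoidsShapes H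
    avoids-shapes H no-copy xs u 0<e s∈ = no-copy (∈-copies⁺ s∈ u (filter∈sublists H (pairs xs))) nonempty
      (λ x∈ → proj₂ (∈-filter⁻ (λ f → H f Boolₚ.≟ true) {xs = pairs xs} x∈))
      where
      nonempty : filter (λ f → H f Boolₚ.≟ true) (pairs xs) ≢ []
      nonempty eq = <⇒≢ 0<e (sym (cong length eq))

    meets : ∀ t H → (∀ {T} → T ∈ independent-candidates t → ∃[ x ] (x ∈ T × H x ≡ true)) → Meets t H
    meets t H hits xs u refl with hits (∈-map⁺ pairs (∈-filter⁺ unique? (∈-tuples xs) u))
    ... | f , f∈ , Hf with ∈-pairs⁻ xs u f∈
    ...   | x , y , x∈ , y∈ , x≢y , refl = x , y , x∈ , y∈ , x≢y , Hf

    avoiding-graph : ∀ t → n ^ t * (1 + 2 * L) ^ tri t < (2 + 2 * L) ^ tri t →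
      ∃[ H ] (AvoidsShapes H × Meets t H)
    avoiding-graph t small = Product.map₂ (λ {H} → Product.map (avoids-shapes H) (meets t H))
      (deletion copies copies-unique copies-at Ts (tri t) Ts-shape
        (≤-<-trans (*-monoˡ-≤ ((1 + 2 * L) ^ tri t) |Ts|) small))
      where
      open Deletion L (n * n) copiesAt light

      Ts = independent-candidates t

      Ts-shape : ∀ {T} → T ∈ Ts → Unique T × length T ≡ tri t
      Ts-shape T∈ with ∈-map⁻ pairs T∈
      ... | xs , xs∈ , refl with ∈-filter⁻ unique? {xs = tuples t} xs∈
      ...   | xs∈t , u = Unique-pairs xs u , trans (length-pairs xs) (cong tri (∈-tuples⁻ t xs∈t))

      |Ts| : length Ts ≤ n ^ t
      |Ts| = begin
        length Ts                            ≡⟨ length-map pairs (filter unique? (tuples t)) ⟩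
        length (filter unique? (tuples t))   ≤⟨ length-filter unique? (tuples t) ⟩
        length (tuples t)                    ≡⟨ length-tuples t ⟩
        n ^ t                                ∎

  -- The complement of the graph with edge set `H`

  module Complement (H : Fin (n * n) → Bool) where

    nonadjacent : Fin n → Fin n → Bool
    nonadjacent x y = not (does (x Finₚ.≟ y)) ∧ not (H (key x y))

    nonadjacent-sym : ∀ x y → nonadjacent x y ≡ nonadjacent y x
    nonadjacent-sym x y rewrite key-sym x y with x Finₚ.≟ y | y Finₚ.≟ x
    ... | yes _ | yes _ = refl
    ... | no _  | no _  = refl
    ... | yes p | no q  = contradiction (sym p) q
    ... | no p  | yes q = contradiction (sym q) p

    nonadjacent-irrefl : ∀ x → nonadjacent x x ≡ false
    nonadjacent-irrefl x with x Finₚ.≟ x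
    ... | yes _ = refl
    ... | no p  = contradiction refl p

    nonadjacent⇒ : ∀ x y → nonadjacent x y ≡ true → x ≢ y × H (key x y) ≡ false
    nonadjacent⇒ x y eq with x Finₚ.≟ y | H (key x y)
    ... | no p | false = p , refl

    open Symmetric nonadjacent nonadjacent-sym nonadjacent-irrefl using (deg; edges)

    private
      H? = λ f → H f Boolₚ.≟ true

      filter-length-++ : ∀ fs gs → length (filter H? (fs ++ gs)) ≡ length (filter H? fs) + length (filter H? gs)
      filter-length-++ []       gs = refl
      filter-length-++ (f ∷ fs) gs with H f
      ... | true  = cong suc (filter-length-++ fs gs)
      ... | false = filter-length-++ fs gs

      row : ∀ x ys → x ∉ ys → length (filter H? (map (key x) ys)) + deg x ys ≡ length ys
      row x []       _  = refl
      row x (y ∷ ys) x∉ with x Finₚ.≟ y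
      ... | yes x≡y = contradiction (here x≡y) x∉
      ... | no  _ with H (key x y)
      ...   | true  = cong suc (row x ys (x∉ ∘ there))
      ...   | false = trans (+-suc _ _) (cong suc (row x ys (x∉ ∘ there)))

    edges-complement : ∀ xs → Unique xs →
      length (filter (λ f → H f Boolₚ.≟ true) (pairs xs)) + edges xs ≡ tri (length xs)
    edges-complement []       _             = refl
    edges-complement (x ∷ xs) u@(_ ∷ uxs) = trans
      (cong (_+ (deg x xs + edges xs)) (filter-length-++ (map (key x) xs) (pairs xs)))
      (trans (lemma (length (filter H? (map (key x) xs))) _ (deg x xs) (edges xs))
        (cong₂ _+_ (row x xs (Unique[x∷xs]⇒x∉xs u)) (edges-complement xs uxs)))
      where
      lemma : ∀ a b c d → a + b + (c + d) ≡ a + c + (b + d)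
      lemma = solve-∀

-- Choice of the parameters

^-distribʳ-* : ∀ o m n → (m * n) ^ o ≡ m ^ o * n ^ o
^-distribʳ-* zero    m n = refl
^-distribʳ-* (suc o) m n =
  trans (cong (m * n *_) (^-distribʳ-* o m n)) ([m*n]*[o*p]≡[m*o]*[n*p] m n (m ^ o) (n ^ o))

n<2^n : ∀ n → n < 2 ^ n
n<2^n zero    = s≤s z≤n
n<2^n (suc n) = begin-strict
  suc n          ≡⟨ +-comm 1 n ⟩
  n + 1          <⟨ +-mono-<-≤ (n<2^n n) (≤-trans (m^n>0 2 n) (m≤m+n _ 0)) ⟩
  2 ^ suc n      ∎

m≤m^n : ∀ m {n} → 0 < n → m ≤ m ^ n
m≤m^n zero          _ = z≤n
m≤m^n (suc m) {suc n} _ = m≤m*n (suc m) (suc m ^ n) {{m^n≢0 (suc m) n}}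

^-cancelˡ-≤ : ∀ q {a b} → a ^ q ≤ b ^ q → 0 < q → a ≤ b
^-cancelˡ-≤ q le 0<q = ≮⇒≥ λ b<a → <⇒≱ (^-monoˡ-< q {{>-nonZero 0<q}} b<a) le

-- For `D = 2 * e` and `i = j / D`, `2^j` is at least `(2^i)^D ≥ (i + 1)^(2e)`. One factor
-- `(i + 1)^e` takes care of the polynomial in `j`, the other of the constant `B`.
2^dominates : ∀ C d → ∃[ J ] (∀ j → J ≤ j → C * suc j ^ suc d ≤ 2 ^ j)
2^dominates C d = D * B , bound
  where
  e = suc d
  D = 2 * e
  B = C * D ^ e
  bound : ∀ j → D * B ≤ j → C * suc j ^ e ≤ 2 ^ j
  bound j J≤j = begin
    C * suc j ^ e               ≤⟨ *-monoʳ-≤ C (^-monoˡ-≤ e 1+j≤) ⟩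
    C * (D * suc i) ^ e         ≡⟨ cong (C *_) (^-distribʳ-* e D (suc i)) ⟩
    C * (D ^ e * suc i ^ e)     ≡⟨ *-assoc C (D ^ e) (suc i ^ e) ⟨
    B * suc i ^ e               ≤⟨ *-monoˡ-≤ (suc i ^ e) (≤-trans B≤1+i (m≤m^n (suc i) {e} (s≤s z≤n))) ⟩
    suc i ^ e * suc i ^ e       ≡⟨ ^-distribˡ-+-* (suc i) e e ⟨
    suc i ^ (e + e)             ≡⟨ cong (λ k → suc i ^ (e + k)) (+-identityʳ e) ⟨
    suc i ^ D                   ≤⟨ ^-monoˡ-≤ D (n<2^n i) ⟩
    (2 ^ i) ^ D                 ≡⟨ ^-*-assoc 2 i D ⟩
    2 ^ (i * D)                 ≤⟨ ^-monoʳ-≤ 2 (≤-trans (m≤n+m (i * D) (j % D)) (≤-reflexive (sym (m≡m%n+[m/n]*n j D)))) ⟩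
    2 ^ j                       ∎
    where
    i = j / D
    1+j≤ : suc j ≤ D * suc i
    1+j≤ = begin
      suc j                ≡⟨ cong suc (m≡m%n+[m/n]*n j D) ⟩
      suc (j % D) + i * D  ≤⟨ +-monoˡ-≤ (i * D) (m%n<n j D) ⟩
      suc i * D            ≡⟨ *-comm (suc i) D ⟩
      D * suc i            ∎
    B≤1+i : B ≤ suc i
    B≤1+i = *-cancelˡ-≤ D (≤-trans J≤j (≤-trans (n≤1+n j) 1+j≤))

-- Bernoulli's inequality `(1 + 1/c)^i ≥ 1 + i/c`, cleared of denominators.
bernoulli : ∀ c i → (c + i) * c ^ i ≤ c * suc c ^ i
bernoulli c zero    = ≤-reflexive (cong (_* 1) (+-identityʳ c))
bernoulli c (suc i) = begin
  (c + suc i) * (c * c ^ i)      ≤⟨ ≤-by (i * c ^ i) (lemma c i (c ^ i)) ⟩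
  suc c * ((c + i) * c ^ i)      ≤⟨ *-monoʳ-≤ (suc c) (bernoulli c i) ⟩
  suc c * (c * suc c ^ i)        ≡⟨ lemma′ c (suc c ^ i) ⟩
  c * (suc c * suc c ^ i)        ∎
  where
  lemma : ∀ c i p → (c + suc i) * (c * p) + i * p ≡ suc c * ((c + i) * p)
  lemma = solve-∀
  lemma′ : ∀ c p → suc c * (c * p) ≡ c * (suc c * p)
  lemma′ = solve-∀

2*c^c≤ : ∀ c .{{_ : NonZero c}} → 2 * c ^ c ≤ suc c ^ c
2*c^c≤ c = *-cancelˡ-≤ c (≤-trans (≤-reflexive (lemma c (c ^ c))) (bernoulli c c))
  where
  lemma : ∀ c p → c * (2 * p) ≡ (c + c) * p
  lemma = solve-∀

-- For `t = k + 1` and `c = 1 + 2 * L`, `n^t` is below `2^(ℓ t)`, and every block of `c` pairs gains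
-- a factor `(1 + 1/c)^c ≥ 2`. The `tri t = t k / 2` pairs contain the `ℓ t` blocks needed.
few-candidates : ∀ {n ℓ k L} → n < 2 ^ ℓ → 2 * (1 + 2 * L) * ℓ ≤ k →
  n ^ suc k * (1 + 2 * L) ^ tri (suc k) < (2 + 2 * L) ^ tri (suc k)
few-candidates {n} {ℓ} {k} {L} n<2^ℓ le with m≤n⇒∃[o]m+o≡n cx≤
  where
  c = 1 + 2 * L
  x = ℓ * suc k
  lemma : ∀ c l t → 2 * (c * (l * t)) ≡ t * (2 * c * l)
  lemma = solve-∀
  cx≤ : c * x ≤ tri (suc k)
  cx≤ = *-cancelˡ-≤ 2 (begin
    2 * (c * x)               ≡⟨ lemma c ℓ (suc k) ⟩
    suc k * (2 * c * ℓ)       ≤⟨ *-monoʳ-≤ (suc k) le ⟩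
    suc k * k                 ≡⟨ 2*tri k ⟨
    2 * tri (suc k)           ∎)
... | y , eq = subst (λ τ → n ^ suc k * c ^ τ < s ^ τ) eq (begin-strict
    n ^ suc k * c ^ (c * x + y)           ≡⟨ cong (n ^ suc k *_) (^-distribˡ-+-* c (c * x) y) ⟩
    n ^ suc k * (c ^ (c * x) * c ^ y)     <⟨ *-monoˡ-< (c ^ (c * x) * c ^ y) {{m*n≢0 _ _ {{m^n≢0 c (c * x)}} {{m^n≢0 c y}}}} n^t< ⟩
    2 ^ x * (c ^ (c * x) * c ^ y)         ≡⟨ *-assoc (2 ^ x) _ _ ⟨
    2 ^ x * c ^ (c * x) * c ^ y           ≤⟨ *-mono-≤ base (^-monoˡ-≤ y (n≤1+n c)) ⟩
    s ^ (c * x) * s ^ y                   ≡⟨ ^-distribˡ-+-* s (c * x) y ⟨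
    s ^ (c * x + y)                       ∎)
  where
  c = 1 + 2 * L
  s = 2 + 2 * L
  x = ℓ * suc k
  n^t< : n ^ suc k < 2 ^ x
  n^t< = <-≤-trans (^-monoˡ-< (suc k) n<2^ℓ) (≤-reflexive (^-*-assoc 2 ℓ (suc k)))
  base : 2 ^ x * c ^ (c * x) ≤ s ^ (c * x)
  base = begin
    2 ^ x * c ^ (c * x)   ≡⟨ cong (2 ^ x *_) (^-*-assoc c c x) ⟨
    2 ^ x * (c ^ c) ^ x   ≡⟨ ^-distribʳ-* x 2 (c ^ c) ⟨
    (2 * c ^ c) ^ x       ≤⟨ ^-monoˡ-≤ x (2*c^c≤ c) ⟩
    (s ^ c) ^ x           ≡⟨ ^-*-assoc s c x ⟩
    s ^ (c * x)           ∎

-- k is the integer part of n^(p/q), and the edge probability 1/(L+1) is chosen so that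
-- k is about 6 L log₂ n.
parameters : ∀ p q M d → 0 < p → 0 < q → 0 < M → ∃[ N ] (∀ n → N ≤ n →
  ∃[ k ] ∃[ L ] (k ^ q ≤ n ^ p × 0 < L ×
    n ^ suc k * (1 + 2 * L) ^ tri (suc k) < (2 + 2 * L) ^ tri (suc k) ×
    (∀ w E → q * w < p * E → E ≤ suc d → M * n ^ w ≤ L ^ E)))
parameters p q@(suc q′) M d 0<p 0<q 0<M = 2 ^ J , choose
  where
  D = q * suc d
  C = M ^ q * 12 ^ D
  -- `J` ensures `M^q (12 ℓ)^D ≤ n` for `ℓ = j + 1`; the argument `d + q′ * suc d` is `D - 1`.
  J = proj₁ (2^dominates C (d + q′ * suc d))

  choose : ∀ n → 2 ^ J ≤ n → _
  choose n N≤n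
    with last-true (λ k → k ^ q ≤? n ^ p) z≤n (suc (n ^ p)) (<⇒≱ (m≤m^n (suc (n ^ p)) 0<q))
       | last-true (λ j → 2 ^ j ≤? n) (≤-trans (m^n>0 2 J) N≤n) n (<⇒≱ (n<2^n n))
  ... | k , k^q≤ , t^q≰ | j , 2^j≤n , n≮
    with last-true (λ L → 6 * suc j * L ≤? k) (≤-trans (≤-reflexive (*-zeroʳ (6 * suc j))) z≤n) (suc k)
           (<⇒≱ (m≤n*m (suc k) (6 * suc j)))
  ... | L , L≤ , L≰ = k , L , k^q≤ , 0<L , few-candidates {ℓ = suc j} {L = L} (≰⇒> n≮) room , powers
    where
    ℓ = suc j
    t = suc k

    n^p<t^q : n ^ p < t ^ q
    n^p<t^q = ≰⇒> t^q≰

    J≤j : J ≤ j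
    J≤j = ≮⇒≥ λ j<J → n≮ (≤-trans (^-monoʳ-≤ 2 j<J) N≤n)

    n-large : M ^ q * (12 * ℓ) ^ D ≤ n
    n-large = begin
      M ^ q * (12 * ℓ) ^ D         ≡⟨ cong (M ^ q *_) (^-distribʳ-* D 12 ℓ) ⟩
      M ^ q * (12 ^ D * ℓ ^ D)     ≡⟨ *-assoc (M ^ q) (12 ^ D) (ℓ ^ D) ⟨
      C * ℓ ^ D                    ≤⟨ proj₂ (2^dominates C (d + q′ * suc d)) j J≤j ⟩
      2 ^ j                        ≤⟨ 2^j≤n ⟩
      n                            ∎

    -- With `L = 0` one would have `t ≤ 6 ℓ`, making `n^(p/q)` logarithmic in `n`.
    0<L : 0 < L
    0<L = n≢0⇒n>0 λ { refl → <-irrefl refl (begin-strict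
      n                       ≤⟨ m≤m^n n 0<p ⟩
      n ^ p                   <⟨ n^p<t^q ⟩
      t ^ q                   ≤⟨ ^-monoˡ-≤ q (≤-trans (≰⇒> L≰) (≤-reflexive (*-identityʳ (6 * ℓ)))) ⟩
      (6 * ℓ) ^ q             ≤⟨ ^-monoˡ-≤ q (*-monoˡ-≤ ℓ (≤-by {6} 6 refl)) ⟩
      (12 * ℓ) ^ q            ≤⟨ ^-monoʳ-≤ (12 * ℓ) (m≤m*n q (suc d)) ⟩
      (12 * ℓ) ^ D            ≤⟨ m≤n*m _ (M ^ q) {{m^n≢0 M q {{>-nonZero 0<M}}}} ⟩
      M ^ q * (12 * ℓ) ^ D    ≤⟨ n-large ⟩
      n                       ∎) }

    room : 2 * (1 + 2 * L) * ℓ ≤ k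
    room = begin
      2 * (1 + 2 * L) * ℓ     ≤⟨ *-monoˡ-≤ ℓ (*-monoʳ-≤ 2 (+-monoˡ-≤ (2 * L) 0<L)) ⟩
      2 * (L + 2 * L) * ℓ     ≡⟨ lemma L ℓ ⟩
      6 * ℓ * L               ≤⟨ L≤ ⟩
      k                       ∎
      where
      lemma : ∀ L l → 2 * (L + 2 * L) * l ≡ 6 * l * L
      lemma = solve-∀

    t≤ : t ≤ 12 * ℓ * L
    t≤ = begin
      t                     ≤⟨ ≰⇒> L≰ ⟩
      6 * ℓ * suc L         ≤⟨ *-monoʳ-≤ (6 * ℓ) (+-monoˡ-≤ L 0<L) ⟩
      6 * ℓ * (L + L)       ≡⟨ lemma ℓ L ⟩
      12 * ℓ * L            ∎
      where
      lemma : ∀ l L → 6 * l * (L + L) ≡ 12 * l * L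
      lemma = solve-∀

    -- By `t ≤ 12 ℓ L`, the bound `n^p < t^q` bounds `L` from below up to a logarithmic factor. The
    -- strict inequality `q w < p E` leaves one spare factor `n`, which pays for that factor and for
    -- `M^q`.
    powers : ∀ w E → q * w < p * E → E ≤ suc d → M * n ^ w ≤ L ^ E
    powers w E qw<pE E≤d = ^-cancelˡ-≤ q (*-cancelˡ-≤ (b ^ (q * E)) {{m^n≢0 b (q * E)}} (begin
      b ^ (q * E) * (M * n ^ w) ^ q       ≡⟨ cong (b ^ (q * E) *_) (^-distribʳ-* q M (n ^ w)) ⟩
      b ^ (q * E) * (M ^ q * (n ^ w) ^ q)
        ≤⟨ *-monoˡ-≤ _ (^-monoʳ-≤ b (*-monoʳ-≤ q E≤d)) ⟩
      b ^ D * (M ^ q * (n ^ w) ^ q)       ≡⟨ lemma (b ^ D) (M ^ q) ((n ^ w) ^ q) ⟩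
      M ^ q * b ^ D * (n ^ w) ^ q         ≤⟨ *-monoˡ-≤ ((n ^ w) ^ q) n-large ⟩
      n * (n ^ w) ^ q                     ≡⟨ cong (n *_) (trans (^-*-assoc n w q) (cong (n ^_) (*-comm w q))) ⟩
      n ^ suc (q * w)                     ≤⟨ ^-monoʳ-≤ n {{>-nonZero 0<n}} qw<pE ⟩
      n ^ (p * E)                         ≡⟨ ^-*-assoc n p E ⟨
      (n ^ p) ^ E                         ≤⟨ ^-monoˡ-≤ E (<⇒≤ n^p<t^q) ⟩
      (t ^ q) ^ E                         ≡⟨ ^-*-assoc t q E ⟩
      t ^ (q * E)                         ≤⟨ ^-monoˡ-≤ (q * E) t≤ ⟩
      (b * L) ^ (q * E)                   ≡⟨ ^-distribʳ-* (q * E) b L ⟩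
      b ^ (q * E) * L ^ (q * E)           ≡⟨ cong (b ^ (q * E) *_) (trans (cong (L ^_) (*-comm q E)) (sym (^-*-assoc L E q))) ⟩
      b ^ (q * E) * (L ^ E) ^ q           ∎)) 0<q
      where
      b = 12 * ℓ
      0<n : 0 < n
      0<n = ≤-trans (m^n>0 2 J) N≤n
      lemma : ∀ a m x → a * (m * x) ≡ m * a * x
      lemma = solve-∀

-- The graph

length-⊆ : ∀ {A : Set} {ys xs : List A} → Unique ys → (∀ {y} → y ∈ ys → y ∈ xs) → length ys ≤ length xs
length-⊆ {ys = []}     _ _ = z≤n
length-⊆ {ys = y ∷ ys} u@(_ ∷ uys) sub with ∈-∃++ (sub (here refl))
... | as , bs , refl = begin
  suc (length ys)            ≤⟨ s≤s (length-⊆ uys sub′) ⟩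
  suc (length (as ++ bs))    ≡⟨ cong suc (length-++ as) ⟩
  suc (length as + length bs) ≡⟨ +-suc (length as) (length bs) ⟨
  length as + suc (length bs) ≡⟨ length-++ as ⟨
  length (as ++ y ∷ bs)      ∎
  where
  sub′ : ∀ {z} → z ∈ ys → z ∈ as ++ bs
  sub′ z∈ with ∈-++⁻ as (sub (there z∈))
  ... | inj₁ p           = ∈-++⁺ˡ p
  ... | inj₂ (here refl) = contradiction z∈ (Unique[x∷xs]⇒x∉xs u)
  ... | inj₂ (there p)   = ∈-++⁺ʳ as p

tri-mono : ∀ {v w} → v ≤ w → tri v ≤ tri w
tri-mono z≤n       = z≤n
tri-mono (s≤s v≤w) = +-mono-≤ v≤w (tri-mono v≤w)

-- Subsets as lists of distinct elements

elements : ∀ {n} → Subset n → List (Fin n)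
elements []            = []
elements (inside  ∷ S) = zero ∷ map suc (elements S)
elements (outside ∷ S) = map suc (elements S)

length-elements : ∀ {n} (S : Subset n) → length (elements S) ≡ ∣ S ∣
length-elements []            = refl
length-elements (inside  ∷ S) = cong suc (trans (length-map suc (elements S)) (length-elements S))
length-elements (outside ∷ S) = trans (length-map suc (elements S)) (length-elements S)

Unique-elements : ∀ {n} (S : Subset n) → Unique (elements S)
Unique-elements []            = []
Unique-elements (inside  ∷ S) = All.tabulate (λ p → zero∉ p) ∷ Uniqueₚ.map⁺ Finₚ.suc-injective (Unique-elements S)
  where
  zero∉ : ∀ {x} → x ∈ map suc (elements S) → zero ≢ x
  zero∉ p refl with ∈-map⁻ suc p
  ... | _ , _ , ()
Unique-elements (outside ∷ S) = Uniqueₚ.map⁺ Finₚ.suc-injective (Unique-elements S)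

∈-elements : ∀ {n} (S : Subset n) {x} → x ∈ elements S → x ∈ₛ S
∈-elements (inside  ∷ S) (here refl) = here
∈-elements (inside  ∷ S) (there p) with ∈-map⁻ suc p
... | _ , y∈ , refl = there (∈-elements S y∈)
∈-elements (outside ∷ S) p with ∈-map⁻ suc p
... | _ , y∈ , refl = there (∈-elements S y∈)

fromList : ∀ {n} → List (Fin n) → Subset n
fromList []       = ∅
fromList (x ∷ xs) = fromList xs [ x ]≔ inside

∈-fromList⁻ : ∀ {n} (xs : List (Fin n)) {x} → x ∈ₛ fromList xs → x ∈ xs
∈-fromList⁻ []       p = contradiction p ∉⊥
∈-fromList⁻ (y ∷ xs) {x} p with x Finₚ.≟ y
... | yes x≡y = here x≡y
... | no  x≢y = there (∈-fromList⁻ xs (lookup⇒[]= x (fromList xs)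
                  (trans (sym (lookup∘update′ x≢y (fromList xs) inside)) ([]=⇒lookup p))))

∣insert∣ : ∀ {n} (S : Subset n) x → ¬ x ∈ₛ S → ∣ S [ x ]≔ inside ∣ ≡ suc ∣ S ∣
∣insert∣ (inside  ∷ S) zero    x∉ = contradiction here x∉
∣insert∣ (outside ∷ S) zero    x∉ = refl
∣insert∣ (inside  ∷ S) (suc x) x∉ = cong suc (∣insert∣ S x (x∉ ∘ there))
∣insert∣ (outside ∷ S) (suc x) x∉ = ∣insert∣ S x (x∉ ∘ there)

∣fromList∣ : ∀ {n} (xs : List (Fin n)) → Unique xs → ∣ fromList xs ∣ ≡ length xs
∣fromList∣ {n} []    _             = ∣⊥∣≡0 n
∣fromList∣ (x ∷ xs) u@(_ ∷ uxs) = trans (∣insert∣ (fromList xs) x (Unique[x∷xs]⇒x∉xs u ∘ ∈-fromList⁻ xs))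
                                        (cong suc (∣fromList∣ xs uxs))

Result : ℕ → ℕ → ℕ → Set₁
Result m p q = ∃[ N ] ((n : ℕ) → N ≤ n →
  ∃[ G ] (AlphaMAtLeast3 {n} m G × ∃[ k ] (AlphaAtMost G k × k ^ q ≤ n ^ p)))

-- For `p / q ≥ 1` the required bound is at least `n`, so the edgeless graph serves.
large-exponent : ∀ {m p q} → 5 ≤ m → q ≤ p → Result m p q
large-exponent {m} {p} {q} 5≤m q≤p = 1 , λ n 1≤n → empty n , triples , n ,
  (λ S _ → ∣p∣≤n S) , ^-monoʳ-≤ n {{>-nonZero 1≤n}} q≤p
  where
  empty : ∀ n → Graph n
  empty n = record { Adj = λ _ _ → ⊥ ; sym = id ; irrefl = id }
  triples : ∀ {n} → AlphaMAtLeast3 m (empty n)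
  triples S refl = fromList xs , (λ x∈ → ∈-elements S (∈-take 3 (elements S) (∈-fromList⁻ xs x∈))) ,
    trans (∣fromList∣ xs (Uniqueₚ.take⁺ 3 (Unique-elements S)))
      (trans (length-take 3 (elements S)) (trans (cong (3 ⊓_) (length-elements S))
        (m≤n⇒m⊓n≡m (≤-trans (≤-by 2 refl) 5≤m)))) , λ _ _ _ _ ()
    where xs = take 3 (elements S)

module Construction {m p q : ℕ} (5≤m : 5 ≤ m) (0<q : 0 < q) (p<q : p < q) (ex : ExponentAbove m p q) where

  open Exponent p q

  good? : ∀ s → Dec (Good (proj₁ s) (proj₂ s))
  good? (v , e) = q * (v ∸ 2) <? p * (e ∸ 1)

  shapes : List (ℕ × ℕ)
  shapes = filter good? (cartesianProduct (upTo (suc m)) (upTo (suc (tri m))))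

  ∈-shapes⁻ : ∀ {v e} → (v , e) ∈ shapes → v ≤ m × e ≤ tri m × Good v e
  ∈-shapes⁻ s∈ with ∈-filter⁻ good? {xs = cartesianProduct (upTo (suc m)) (upTo (suc (tri m)))} s∈
  ... | s∈′ , good with ∈-cartesianProduct⁻ (upTo (suc m)) (upTo (suc (tri m))) s∈′
  ...   | v∈ , e∈ = s≤s⁻¹ (∈-upTo⁻ v∈) , s≤s⁻¹ (∈-upTo⁻ e∈) , good

  ∈-shapes⁺ : ∀ {v e} → v ≤ m → e ≤ tri m → Good v e → (v , e) ∈ shapes
  ∈-shapes⁺ v≤ e≤ good = ∈-filter⁺ good? (∈-cartesianProduct⁺ (∈-upTo⁺ (s≤s v≤)) (∈-upTo⁺ (s≤s e≤))) good

  multiplicity : ℕ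
  multiplicity = 3 * (length shapes * (m * m * 2 ^ tri m))

  rare : ∀ {n L} → 0 < L → (∀ w E → q * w < p * E → E ≤ suc (tri m) → suc multiplicity * n ^ w ≤ L ^ E) →
    ∀ {v e} → (v , e) ∈ shapes → (1 + 2 * L) * (length shapes * (v * v * n ^ (v ∸ 2) * 2 ^ tri v)) ≤ L ^ e
  rare {n} {L} 0<L powers {v} {e} s∈ with ∈-shapes⁻ s∈
  rare {n} {L} 0<L powers {v} {zero} s∈ | _ , _ , good =
    contradiction good (≤⇒≯ (≤-trans (≤-reflexive (*-zeroʳ p)) z≤n))
  rare {n} {L} 0<L powers {v} {suc E} s∈ | v≤m , E<tri , good = begin
    (1 + 2 * L) * (K * (v * v * n ^ w * 2 ^ tri v))
      ≤⟨ *-mono-≤ (+-monoˡ-≤ (2 * L) 0<L)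
           (*-monoʳ-≤ K (*-mono-≤ (*-monoˡ-≤ (n ^ w) (*-mono-≤ v≤m v≤m)) (^-monoʳ-≤ 2 (tri-mono v≤m)))) ⟩
    (L + 2 * L) * (K * (m * m * n ^ w * 2 ^ tri m))
      ≡⟨ lemma L K (m * m) (n ^ w) (2 ^ tri m) ⟩
    L * (multiplicity * n ^ w)
      -- One of the `suc E` factors `L` has absorbed `1 + 2 * L ≤ 3 * L`, whose 3 sits in
      -- `multiplicity`; the other `E` dominate the number of copies.
      ≤⟨ *-monoʳ-≤ L (≤-trans (*-monoˡ-≤ (n ^ w) (n≤1+n multiplicity))
           (powers w E good (≤-trans (n≤1+n E) (≤-trans E<tri (n≤1+n (tri m)))))) ⟩
    L * L ^ E ∎
    where
    K = length shapes
    w = v ∸ 2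
    lemma : ∀ L K a x b → (L + 2 * L) * (K * (a * x * b)) ≡ L * (3 * (K * (a * b)) * x)
    lemma = solve-∀

  module _ {n : ℕ} (H : Fin (n * n) → Bool) where

    open Pairs n
    open Complement H
    open Symmetric nonadjacent nonadjacent-sym nonadjacent-irrefl using (TriangleFree; sparse; edges)

    graph : Graph n
    graph = record
      { Adj    = λ x y → x ≢ y × H (key x y) ≡ true
      ; sym    = λ {x} {y} (x≢y , e) → (λ y≡x → x≢y (sym y≡x)) , trans (cong H (key-sym y x)) e
      ; irrefl = λ (x≢x , _) → x≢x refl }

    alpha-at-most : ∀ {k} → (∀ xs → Unique xs → length xs ≡ suc k →
        ∃[ x ] ∃[ y ] (x ∈ xs × y ∈ xs × x ≢ y × H (key x y) ≡ true)) →
      AlphaAtMost graph k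
    alpha-at-most {k} meets S indep = ≮⇒≥ λ k<S → large k<S
      where
      xs = take (suc k) (elements S)
      ∈S : ∀ {x} → x ∈ xs → x ∈ₛ S
      ∈S = ∈-elements S ∘ ∈-take (suc k) (elements S)
      large : k < ∣ S ∣ → ⊥
      large k<S with meets xs (Uniqueₚ.take⁺ (suc k) (Unique-elements S))
                       (trans (length-take (suc k) (elements S))
                         (trans (cong (suc k ⊓_) (length-elements S)) (m≤n⇒m⊓n≡m k<S)))
      ... | x , y , x∈ , y∈ , x≢y , e = indep x y (∈S x∈) (∈S y∈) (x≢y , e)

    independent-triple : ∀ x y z → nonadjacent x y ≡ true → nonadjacent x z ≡ true → nonadjacent y z ≡ true →
      let T = fromList (x ∷ y ∷ z ∷ []) in ∣ T ∣ ≡ 3 × Independent graph T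
    independent-triple x y z xy xz yz =
      ∣fromList∣ (x ∷ y ∷ z ∷ []) ((x≢y ∷ x≢z ∷ []) ∷ (y≢z ∷ []) ∷ [] ∷ []) ,
      λ i j i∈ j∈ → go (∈-fromList⁻ (x ∷ y ∷ z ∷ []) i∈) (∈-fromList⁻ (x ∷ y ∷ z ∷ []) j∈)
      where
      x≢y = proj₁ (nonadjacent⇒ x y xy)
      x≢z = proj₁ (nonadjacent⇒ x z xz)
      y≢z = proj₁ (nonadjacent⇒ y z yz)
      absent : ∀ a b → nonadjacent a b ≡ true → ¬ (a ≢ b × H (key a b) ≡ true)
      absent a b ab (_ , e) = contradiction (trans (sym (proj₂ (nonadjacent⇒ a b ab))) e) λ ()
      flip : ∀ a b → nonadjacent a b ≡ true → nonadjacent b a ≡ true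
      flip a b ab = trans (nonadjacent-sym b a) ab
      go : ∀ {i j} → i ∈ x ∷ y ∷ z ∷ [] → j ∈ x ∷ y ∷ z ∷ [] → ¬ (i ≢ j × H (key i j) ≡ true)
      go (here refl)                 (here refl)                 (i≢i , _) = i≢i refl
      go (here refl)                 (there (here refl))         = absent x y xy
      go (here refl)                 (there (there (here refl))) = absent x z xz
      go (there (here refl))         (here refl)                 = absent y x (flip x y xy)
      go (there (here refl))         (there (here refl))         (i≢i , _) = i≢i refl
      go (there (here refl))         (there (there (here refl))) = absent y z yz
      go (there (there (here refl))) (here refl)                 = absent z x (flip x z xz)
      go (there (there (here refl))) (there (here refl))         = absent z y (flip y z yz)
      go (there (there (here refl))) (there (there (here refl))) (i≢i , _) = i≢i refl

    -- The sparse set found in the complement carries at least `tri v ∸ f` edges of `H`. Having more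
    -- edges keeps a shape good, so its actual edge count gives a forbidden shape.
    no-dense-subgraph : (∀ xs → Unique xs → let e = length (filter (λ f → H f Boolₚ.≟ true) (pairs xs)) in
        0 < e → (length xs , e) ∉ shapes) →
      ∀ {xs} → Unique xs → length xs ≡ m → ¬ TriangleFree xs
    no-dense-subgraph avoids {xs} uxs len tf
      with Dense.dense-subgraph nonadjacent nonadjacent-sym nonadjacent-irrefl p q tf uxs 5≤m ex p<q len
    ... | v , f , sparse ys u sub refl few , good = avoids ys u 0<e (∈-shapes⁺ v≤m e≤ good-e)
      where
      e = length (filter (λ f → H f Boolₚ.≟ true) (pairs ys))
      e+edges : e + edges ys ≡ tri (length ys)
      e+edges = edges-complement ys u
      v≤m : length ys ≤ m
      v≤m = ≤-trans (length-⊆ u sub) (≤-reflexive len)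
      e≤ : e ≤ tri m
      e≤ = ≤-trans (m≤m+n e (edges ys)) (≤-trans (≤-reflexive e+edges) (tri-mono v≤m))
      good-e : Good (length ys) e
      good-e = Good-mono (length ys) {tri (length ys) ∸ f} {e}
        (m≤n+o⇒m∸n≤o _ f (≤-trans (≤-reflexive (trans (sym e+edges) (+-comm e (edges ys)))) (+-monoˡ-≤ e few))) good
      0<e : 0 < e
      0<e = n≢0⇒n>0 λ e≡0 → contradiction (subst (Good (length ys)) e≡0 good-e)
        (≤⇒≯ (≤-trans (≤-reflexive (*-zeroʳ p)) z≤n))

    alphaM-at-least-3 : (∀ xs → Unique xs → let e = length (filter (λ f → H f Boolₚ.≟ true) (pairs xs)) in
        0 < e → (length xs , e) ∉ shapes) → AlphaMAtLeast3 m graph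
    alphaM-at-least-3 avoids S |S| with ∃∈⊎∀∈ (λ x → any? (λ y → any? (λ z →
        nonadjacent x y Boolₚ.≟ true ×-dec nonadjacent x z Boolₚ.≟ true ×-dec nonadjacent y z Boolₚ.≟ true)
        (elements S)) (elements S)) (elements S)
    ... | inj₂ none = ⊥-elim
      (no-dense-subgraph avoids (Unique-elements S) (trans (length-elements S) |S|)
        (λ x∈ y∈ z∈ xy xz yz → none x∈ (lose y∈ (lose z∈ (xy , xz , yz)))))
    ... | inj₁ (x , x∈ , some) with find some
    ...   | y , y∈ , some′ with find some′
    ...     | z , z∈ , xy , xz , yz = fromList (x ∷ y ∷ z ∷ []) , T⊆S , independent-triple x y z xy xz yz
      where
      T⊆S : fromList (x ∷ y ∷ z ∷ []) ⊆ S
      T⊆S w∈ with ∈-fromList⁻ (x ∷ y ∷ z ∷ []) w∈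
      ... | here refl                 = ∈-elements S x∈
      ... | there (here refl)         = ∈-elements S y∈
      ... | there (there (here refl)) = ∈-elements S z∈

  small-exponent : 0 < p → Result m p q
  small-exponent 0<p with parameters p q (suc multiplicity) (tri m) 0<p 0<q (s≤s z≤n)
  ... | N , choose = N , λ n N≤n → build n (choose n N≤n)
    where
    build : ∀ n → ∃[ k ] ∃[ L ] (k ^ q ≤ n ^ p × 0 < L ×
        n ^ suc k * (1 + 2 * L) ^ tri (suc k) < (2 + 2 * L) ^ tri (suc k) ×
        (∀ w E → q * w < p * E → E ≤ suc (tri m) → suc multiplicity * n ^ w ≤ L ^ E)) →
      ∃[ G ] (AlphaMAtLeast3 {n} m G × ∃[ k ] (AlphaAtMost G k × k ^ q ≤ n ^ p))
    build n (k , L , k^q≤ , 0<L , few , powers) = finish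
      (Pairs.Avoid.avoiding-graph n shapes L {{>-nonZero 0<L}} (rare {n} {L} 0<L powers) (suc k) few)
      where
      finish : ∃[ H ] (_ × _) → _
      finish (H , avoids , meets) = graph H , alphaM-at-least-3 H avoids , k , alpha-at-most H meets , k^q≤

exponent-positive : ∀ m p q → ExponentAbove m p q → 0 < p
exponent-positive m (suc p) q _  = s≤s z≤n
exponent-positive m zero    q ex with exponent-cases {m} ex
... | inj₁ (_ , _ , ())
... | inj₂ (_ , _ , () , _)

-- Letting `p / q` decrease to `4 / d(m)` slowly enough as `n` grows turns these bounds for large
-- `n` into one function `ε(n)` tending to 0.
theorem1p6 : (m : ℕ) → 5 ≤ m →
    (p q : ℕ) → 0 < q → ExponentAbove m p q →
    ∃[ N ] ((n : ℕ) → N ≤ n →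
    ∃[ G ] (AlphaMAtLeast3 {n} m G ×
    ∃[ k ] (AlphaAtMost G k × k ^ q ≤ n ^ p)))
theorem1p6 m 5≤m p q 0<q ex with q ≤? p
... | yes q≤p = large-exponent 5≤m q≤p
... | no  q≰p = Construction.small-exponent 5≤m 0<q (≰⇒> q≰p) ex (exponent-positive m p q ex)
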